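{- Let $P$ be a process of the calculus $\mathsf{s}\pi^{+}$ such that $P\vdash\emptyset$ and $P\not\equiv\mathbf 0$. Then there exist a process $Q$ and a non-empty set of names $S$ such that $P\leadsto_S Q$.
   Context: The calculus $\mathsf{s}\pi^{+}$ (a session-typed $\pi$-calculus with non-deterministic choice). Names are $x,y,z,w,\dots$; $\widetilde{x}$ is a finite tuple of names. Processes: $P,Q ::= \mathbf{0}$ (inaction) $\mid [x\leftrightarrow y]$ (forwarder) $\mid (\nu x)(P \mid Q)$ (connect) $\mid P \boxplus Q$ (non-deterministic choice) $\mid \overline{x}[y];(P\mid Q)$ (output of a fresh name $y$) $\mid x(y);P$ (input) $\mid \overline{x}\triangleleft \ell;P$ (select label $\ell$) $\mid x\triangleright\{i:P_i\}_{i\in I}$ (branch, $I$ finite) $\mid \overline{x}[\,]$ (close) $\mid x();P$ (wait) $\mid x.\mathtt{some}_{(w_1,\dots,w_n)};P$ (expect) $\mid \overline{x}.\mathtt{some};P$ (available) $\mid \overline{x}.\mathtt{none}$ (unavailable) $\mid P\mid Q$ (parallel). Name $y$ is bound in $(\nu y)(P\mid Q)$, $\overline{x}[y];(P\mid Q)$, $x(y);P$; $\mathrm{fn}(P)$ is the set of free names. $\boxplus$ is associative; $\boxplus_{i\in I}P_i$ is the choice among all $P_i$. $P\{y/z\}$ is capture-avoiding substitution. In the subscript of expect, names and sets of names are freely combined (union). Structural congruence $\equiv$ is the least congruence with: $P\equiv P'$ if $\alpha$-equivalent; $[x\leftrightarrow y]\equiv[y\leftrightarrow x]$; $P\mid \mathbf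 0\equiv P$; $(P\mid Q)\mid R\equiv P\mid(Q\mid R)$; $P\mid Q\equiv Q\mid P$; $(\nu x)(P\mid Q)\equiv(\nu x)(Q\mid P)$; $P\boxplus P\equiv P$; $P\boxplus Q\equiv Q\boxplus P$; $(P\boxplus Q)\boxplus R\equiv P\boxplus(Q\boxplus R)$; $(\nu x)((P\mid Q)\mid R)\equiv(\nu x)(P\mid R)\mid Q$ if $x\notin\mathrm{fn}(Q)$; $(\nu x)((\nu y)(P\mid Q)\mid R)\equiv(\nu y)((\nu x)(P\mid R)\mid Q)$ if $x\notin\mathrm{fn}(Q)$, $y\notin\mathrm{fn}(R)$. ND-contexts: $N ::= [\cdot]\mid N\mid P\mid (\nu x)(N\mid P)\mid N\boxplus P$; D-contexts $C,D$ are ND-contexts not using the clause $N\boxplus P$. $N[P]$ is hole-filling. Prefixes: $\alpha,\beta ::= \overline{x}[y]\mid x(y)\mid \overline{x}\triangleleft\ell\mid x\triangleright\mid \overline{x}[\,]\mid x()\mid \overline{x}.\mathtt{some}\mid\overline{x}.\mathtt{none}\mid x.\mathtt{some}_{\widetilde{w}}\mid[x\leftrightarrow y]$, with subjects $\mathrm{sub}([x\leftrightarrow y])=\{x,y\}$ and $\mathrm{sub}(\alpha)=\{x\}$ otherwise; $\alpha;P$ denotes a prefixed process. Let $\bowtie$ be the least relation with $\overline{x}[y]\bowtie\overline{x}[z]$, $x(y)\bowtie x(z)$, and $\alpha\bowtie\alpha$. Precongruence $P \succeq_S Q$ (for non-empty $S\subseteq\{x,y\}$) holds when: (1) if $S=\{x\}$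 then $P=(\boxplus_{i\in I}C_i[\alpha_i;P_i])\boxplus(\boxplus_{j\in J}C_j[\beta_j;Q_j])$ and $Q=\boxplus_{i\in I}C_i[\alpha_i;P_i]$ with all $\alpha_i\bowtie\alpha_{i'}$, $\mathrm{sub}(\alpha_i)=\{x\}$, and for all $i,j$: $\alpha_i\not\bowtie\beta_j$ and $x\in\mathrm{fn}(\beta_j;Q_j)$; (2) if $S=\{x,y\}$ then $P=(\boxplus_{i\in I}C_i[[x\leftrightarrow y]])\boxplus(\boxplus_{j\in J}C_j[[x\leftrightarrow z_j]])\boxplus(\boxplus_{k\in K}C_k[\alpha_k;P_k])$ and $Q=\boxplus_{i\in I}C_i[[x\leftrightarrow y]]$ with $z_j\neq y$, $x\in\mathrm{fn}(\alpha_k;P_k)$ and $\alpha_k\not\bowtie[x\leftrightarrow z]$ for all $z$. (Here $C_i,C_j,C_k,D_j$ are D-contexts.) Reduction $\leadsto_S$ (writing $\leadsto_{x}$ for $\leadsto_{\{x\}}$): (Id) $(\nu x)(\boxplus_{i\in I}C_i[[x\leftrightarrow y]]\mid Q)\leadsto_{x,y}\boxplus_{i\in I}C_i[Q\{y/x\}]$. (Comm) $(\nu x)(\boxplus_{i}C_i[\overline{x}[y_i];(P_i\mid Q_i)]\mid\boxplus_{j}D_j[x(z);R_j])\leadsto_x\boxplus_i C_i[(\nu x)(Q_i\mid(\nu w)(P_i\{w/y_i\}\mid\boxplus_j D_j[R_j\{w/z\}]))]$. (Sel) $(\nu x)(\boxplus_iC_i[\overline{x}\triangleleft k';P_i]\mid\boxplus_jD_j[x\triangleright\{k:Q^k_j\}_{k\in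 K}])\leadsto_x(\nu x)(\boxplus_iC_i[P_i]\mid\boxplus_jD_j[Q^{k'}_j])$ if $k'\in K$. (Close) $(\nu x)(\boxplus_iC_i[\overline{x}[\,]]\mid\boxplus_jD_j[x();Q_j])\leadsto_x\boxplus_iC_i[\mathbf 0]\mid\boxplus_jD_j[Q_j]$. (Some) $(\nu x)(\boxplus_iC_i[\overline{x}.\mathtt{some};P_i]\mid\boxplus_jD_j[x.\mathtt{some}_{(w_1,\dots,w_n)};Q_j])\leadsto_x(\nu x)(\boxplus_iC_i[P_i]\mid\boxplus_jD_j[Q_j])$. (None) $(\nu x)(\boxplus_iC_i[\overline{x}.\mathtt{none}]\mid\boxplus_jD_j[x.\mathtt{some}_{(w_1,\dots,w_n)};Q_j])\leadsto_x\boxplus_iC_i[\mathbf 0]\mid\boxplus_jD_j[\overline{w_1}.\mathtt{none}\mid\dots\mid\overline{w_n}.\mathtt{none}]$. ($\succeq$) if $x\in S$, $P\succeq_S P'$, $Q\succeq_S Q'$ and $(\nu x)(P'\mid Q')\leadsto_S R$ then $(\nu x)(P\mid Q)\leadsto_S R$. ($\nu\boxplus$) if $(\nu x)(P\mid N[C[Q_1]\boxplus C[Q_2]])\leadsto_S R$ then $(\nu x)(P\mid N[C[Q_1\boxplus Q_2]])\leadsto_S R$. Closure: if $P\equiv P'\leadsto_S Q'\equiv Q$ then $P\leadsto_S Q$; if $P\leadsto_S P'$ then $(\nu x)(P\mid Q)\leadsto_S(\nu x)(P'\mid Q)$, $P\mid Q\leadsto_S P'\mid Q$, and $P\boxplus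 Q\leadsto_S P'\boxplus Q$. Session types: $A,B::=\mathbf 1\mid\bot\mid A\otimes B\mid A\wp B\mid\oplus\{i:A_i\}_{i\in I}\mid\&\{i:A_i\}_{i\in I}\mid\& A\mid\oplus A$ ($\wp$ is the multiplicative disjunction "par"). Duality $\overline{\cdot}$: $\overline{\mathbf 1}=\bot$, $\overline{\bot}=\mathbf 1$, $\overline{A\otimes B}=\overline A\wp\overline B$, $\overline{A\wp B}=\overline A\otimes\overline B$, $\overline{\oplus\{i:A_i\}}=\&\{i:\overline{A_i}\}$, $\overline{\&\{i:A_i\}}=\oplus\{i:\overline{A_i}\}$, $\overline{\&A}=\oplus\overline A$, $\overline{\oplus A}=\&\overline A$. Contexts $\Gamma$ are finite sets of assignments $x:A$ with distinct names; $\&\Gamma$ means every type in $\Gamma$ has the form $\&A'$. Typing rules for $P\vdash\Gamma$: (cut) from $P\vdash\Gamma,x:A$ and $Q\vdash\Delta,x:\overline A$ infer $(\nu x)(P\mid Q)\vdash\Gamma,\Delta$; (mix) from $P\vdash\Gamma$, $Q\vdash\Delta$ infer $P\mid Q\vdash\Gamma,\Delta$; ($\boxplus$) from $P\vdash\Gamma$, $Q\vdash\Gamma$ infer $P\boxplus Q\vdash\Gamma$; $\mathbf 0\vdash\emptyset$; $[x\leftrightarrow y]\vdash x:A,y:\overline A$; $\overline{x}[\,]\vdash x:\mathbf 1$; from $P\vdash\Gamma$ infer $x();P\vdash\Gamma,x:\bot$; from $P\vdash\Gamma,y:A$ and $Q\vdash\Delta,x:B$ infer $\overline{x}[y];(P\mid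 Q)\vdash\Gamma,\Delta,x:A\otimes B$; from $P\vdash\Gamma,y:A,x:B$ infer $x(y);P\vdash\Gamma,x:A\wp B$; from $P\vdash\Gamma,x:A_j$, $j\in I$ infer $\overline{x}\triangleleft j;P\vdash\Gamma,x:\oplus\{i:A_i\}_{i\in I}$; from $P_i\vdash\Gamma,x:A_i$ for all $i\in I$ infer $x\triangleright\{i:P_i\}_{i\in I}\vdash\Gamma,x:\&\{i:A_i\}_{i\in I}$; from $P\vdash\Gamma,x:A$ infer $\overline{x}.\mathtt{some};P\vdash\Gamma,x:\&A$; $\overline{x}.\mathtt{none}\vdash x:\&A$; from $P\vdash\&\Gamma,x:A$ infer $x.\mathtt{some}_{\mathrm{dom}(\Gamma)};P\vdash\&\Gamma,x:\oplus A$. -}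

module Defs where

open import Data.Nat using (ℕ; zero; suc; _<_; _≟_)
open import Data.Fin using (Fin; zero; suc)
open import Data.List using (List; []; _∷_; map; _++_)
open import Data.List.Membership.Propositional using (_∈_)
open import Data.List.Relation.Unary.All using (All)
open import Data.List.Relation.Unary.Linked using (Linked)
open import Data.List.Relation.Unary.Unique.Propositional using (Unique)
open import Data.List.Relation.Binary.Permutation.Propositional using (_↭_)
open import Data.Product using (_×_; _,_; proj₁; proj₂; ∃)
open import Data.Sum using (_⊎_)
open import Data.Empty using (⊥)
open import Data.Unit using (⊤)
open import Relation.Nullary using (¬_; yes; no)
open import Relation.Binary.PropositionalEquality using (_≡_; _≢_)

Name : Set
Name = ℕ

Label : Set
Label = ℕ

infixr 5 _⊞_
infixr 6 _∥_

data Proc : Set where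
  𝟎       : Proc
  [_↔_]   : Name → Name → Proc
  ν       : Name → Proc → Proc → Proc           -- ν x P Q  =  (νx)(P | Q)
  _⊞_     : Proc → Proc → Proc
  out     : Name → Name → Proc → Proc → Proc    -- out x y P Q = x̄[y];(P | Q)  (y bound in P)
  inp     : Name → Name → Proc → Proc           -- inp x y P = x(y);P  (y bound in P)
  sel     : Name → Label → Proc → Proc
  bra     : Name → List (Label × Proc) → Proc
  close   : Name → Proc
  wait    : Name → Proc → Proc
  expect  : Name → List Name → Proc → Proc
  avail   : Name → Proc → Proc
  unavail : Name → Proc
  _∥_     : Proc → Proc → Proc

infix 4 _∈fn_ _∉fn_

data _∈fn_ (n : Name) : Proc → Set where
  fn-fwdˡ    : ∀ {y} → n ∈fn [ n ↔ y ]
  fn-fwdʳ    : ∀ {x} → n ∈fn [ x ↔ n ]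
  fn-νˡ      : ∀ {x P Q} → n ≢ x → n ∈fn P → n ∈fn ν x P Q
  fn-νʳ      : ∀ {x P Q} → n ≢ x → n ∈fn Q → n ∈fn ν x P Q
  fn-⊞ˡ      : ∀ {P Q} → n ∈fn P → n ∈fn (P ⊞ Q)
  fn-⊞ʳ      : ∀ {P Q} → n ∈fn Q → n ∈fn (P ⊞ Q)
  fn-out-sub : ∀ {y P Q} → n ∈fn out n y P Q
  fn-out-P   : ∀ {x y P Q} → n ≢ y → n ∈fn P → n ∈fn out x y P Q
  fn-out-Q   : ∀ {x y P Q} → n ∈fn Q → n ∈fn out x y P Q
  fn-inp-sub : ∀ {y P} → n ∈fn inp n y P
  fn-inp-P   : ∀ {x y P} → n ≢ y → n ∈fn P → n ∈fn inp x y P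
  fn-sel-sub : ∀ {l P} → n ∈fn sel n l P
  fn-sel-P   : ∀ {x l P} → n ∈fn P → n ∈fn sel x l P
  fn-bra-sub : ∀ {bs} → n ∈fn bra n bs
  fn-bra-P   : ∀ {x bs l P} → (l , P) ∈ bs → n ∈fn P → n ∈fn bra x bs
  fn-close   : n ∈fn close n
  fn-wait-sub : ∀ {P} → n ∈fn wait n P
  fn-wait-P  : ∀ {x P} → n ∈fn P → n ∈fn wait x P
  fn-exp-sub : ∀ {ws P} → n ∈fn expect n ws P
  fn-exp-ws  : ∀ {x ws P} → n ∈ ws → n ∈fn expect x ws P
  fn-exp-P   : ∀ {x ws P} → n ∈fn P → n ∈fn expect x ws P
  fn-avail-sub : ∀ {P} → n ∈fn avail n P
  fn-avail-P : ∀ {x P} → n ∈fn P → n ∈fn avail x P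
  fn-unavail : n ∈fn unavail n
  fn-∥ˡ      : ∀ {P Q} → n ∈fn P → n ∈fn (P ∥ Q)
  fn-∥ʳ      : ∀ {P Q} → n ∈fn Q → n ∈fn (P ∥ Q)

_∉fn_ : Name → Proc → Set
n ∉fn P = ¬ (n ∈fn P)

-- Capture-avoiding substitution P{y/z}, as a relation  Sub y z P P'
-- ("P' is P{y/z}").  The relation is undefined exactly when a binder
-- would capture y; such a P must first be α-renamed (α-equivalence is
-- part of structural congruence and reduction is closed under it).

ren : Name → Name → Name → Name
ren y z n with n ≟ z
... | yes _ = y
... | no  _ = n

mutual
  data Sub (y z : Name) : Proc → Proc → Set where
    s-0       : Sub y z 𝟎 𝟎
    s-fwd     : ∀ {a b} → Sub y z [ a ↔ b ] [ ren y z a ↔ ren y z b ]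
    s-ν-bound : ∀ {P Q} → Sub y z (ν z P Q) (ν z P Q)
    s-ν       : ∀ {b P Q P' Q'} → b ≢ z → b ≢ y → Sub y z P P' → Sub y z Q Q'
              → Sub y z (ν b P Q) (ν b P' Q')
    s-⊞       : ∀ {P Q P' Q'} → Sub y z P P' → Sub y z Q Q' → Sub y z (P ⊞ Q) (P' ⊞ Q')
    s-out-bound : ∀ {a P Q Q'} → Sub y z Q Q'
              → Sub y z (out a z P Q) (out (ren y z a) z P Q')
    s-out     : ∀ {a b P Q P' Q'} → b ≢ z → b ≢ y → Sub y z P P' → Sub y z Q Q'
              → Sub y z (out a b P Q) (out (ren y z a) b P' Q')
    s-inp-bound : ∀ {a P} → Sub y z (inp a z P) (inp (ren y z a) z P)
    s-inp     : ∀ {a b P P'} → b ≢ z → b ≢ y → Sub y z P P'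
              → Sub y z (inp a b P) (inp (ren y z a) b P')
    s-sel     : ∀ {a l P P'} → Sub y z P P' → Sub y z (sel a l P) (sel (ren y z a) l P')
    s-bra     : ∀ {a bs bs'} → SubBr y z bs bs' → Sub y z (bra a bs) (bra (ren y z a) bs')
    s-close   : ∀ {a} → Sub y z (close a) (close (ren y z a))
    s-wait    : ∀ {a P P'} → Sub y z P P' → Sub y z (wait a P) (wait (ren y z a) P')
    s-exp     : ∀ {a ws P P'} → Sub y z P P'
              → Sub y z (expect a ws P) (expect (ren y z a) (map (ren y z) ws) P')
    s-avail   : ∀ {a P P'} → Sub y z P P' → Sub y z (avail a P) (avail (ren y z a) P')
    s-unavail : ∀ {a} → Sub y z (unavail a) (unavail (ren y z a))
    s-∥       : ∀ {P Q P' Q'} → Sub y z P P' → Sub y z Q Q' → Sub y z (P ∥ Q) (P' ∥ Q')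

  data SubBr (y z : Name) : List (Label × Proc) → List (Label × Proc) → Set where
    sb-[] : SubBr y z [] []
    sb-∷  : ∀ {l P P' bs bs'} → Sub y z P P' → SubBr y z bs bs'
          → SubBr y z ((l , P) ∷ bs) ((l , P') ∷ bs')

infix 4 _≡ₛ_

mutual
  data _≡ₛ_ : Proc → Proc → Set where
    ≡-refl  : ∀ {P} → P ≡ₛ P
    ≡-sym   : ∀ {P Q} → P ≡ₛ Q → Q ≡ₛ P
    ≡-trans : ∀ {P Q R} → P ≡ₛ Q → Q ≡ₛ R → P ≡ₛ R
    α-ν     : ∀ {x y P Q P' Q'} → y ∉fn P → y ∉fn Q → Sub y x P P' → Sub y x Q Q'
            → ν x P Q ≡ₛ ν y P' Q'
    α-out   : ∀ {x y y' P P' Q} → y' ∉fn P → Sub y' y P P'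
            → out x y P Q ≡ₛ out x y' P' Q
    α-inp   : ∀ {x y y' P P'} → y' ∉fn P → Sub y' y P P'
            → inp x y P ≡ₛ inp x y' P'
    fwd-sym  : ∀ {x y} → [ x ↔ y ] ≡ₛ [ y ↔ x ]
    ∥-unit   : ∀ {P} → (P ∥ 𝟎) ≡ₛ P
    ∥-assoc  : ∀ {P Q R} → ((P ∥ Q) ∥ R) ≡ₛ (P ∥ (Q ∥ R))
    ∥-comm   : ∀ {P Q} → (P ∥ Q) ≡ₛ (Q ∥ P)
    ν-comm   : ∀ {x P Q} → ν x P Q ≡ₛ ν x Q P
    ⊞-idem   : ∀ {P} → (P ⊞ P) ≡ₛ P
    ⊞-comm   : ∀ {P Q} → (P ⊞ Q) ≡ₛ (Q ⊞ P)
    ⊞-assoc  : ∀ {P Q R} → ((P ⊞ Q) ⊞ R) ≡ₛ (P ⊞ (Q ⊞ R))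
    ν-extr   : ∀ {x P Q R} → x ∉fn Q → ν x (P ∥ Q) R ≡ₛ (ν x P R ∥ Q)
    ν-ν      : ∀ {x y P Q R} → x ∉fn Q → y ∉fn R
             → ν x (ν y P Q) R ≡ₛ ν y (ν x P R) Q
    -- branches are label-indexed families, subscripts of expect are sets
    bra-perm : ∀ {x bs bs'} → bs ↭ bs' → bra x bs ≡ₛ bra x bs'
    exp-perm : ∀ {x ws ws' P} → ws ↭ ws' → expect x ws P ≡ₛ expect x ws' P
    c-ν      : ∀ {x P Q P' Q'} → P ≡ₛ P' → Q ≡ₛ Q' → ν x P Q ≡ₛ ν x P' Q'
    c-⊞      : ∀ {P Q P' Q'} → P ≡ₛ P' → Q ≡ₛ Q' → (P ⊞ Q) ≡ₛ (P' ⊞ Q')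
    c-∥      : ∀ {P Q P' Q'} → P ≡ₛ P' → Q ≡ₛ Q' → (P ∥ Q) ≡ₛ (P' ∥ Q')
    c-out    : ∀ {x y P Q P' Q'} → P ≡ₛ P' → Q ≡ₛ Q' → out x y P Q ≡ₛ out x y P' Q'
    c-inp    : ∀ {x y P P'} → P ≡ₛ P' → inp x y P ≡ₛ inp x y P'
    c-sel    : ∀ {x l P P'} → P ≡ₛ P' → sel x l P ≡ₛ sel x l P'
    c-bra    : ∀ {x bs bs'} → BrEq bs bs' → bra x bs ≡ₛ bra x bs'
    c-wait   : ∀ {x P P'} → P ≡ₛ P' → wait x P ≡ₛ wait x P'
    c-exp    : ∀ {x ws P P'} → P ≡ₛ P' → expect x ws P ≡ₛ expect x ws P'
    c-avail  : ∀ {x P P'} → P ≡ₛ P' → avail x P ≡ₛ avail x P'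

  data BrEq : List (Label × Proc) → List (Label × Proc) → Set where
    be-[] : BrEq [] []
    be-∷  : ∀ {l P P' bs bs'} → P ≡ₛ P' → BrEq bs bs' → BrEq ((l , P) ∷ bs) ((l , P') ∷ bs')

data DCtx : Set where
  hole : DCtx
  dpar : DCtx → Proc → DCtx
  dnu  : Name → DCtx → Proc → DCtx

data NCtx : Set where
  nhole : NCtx
  npar  : NCtx → Proc → NCtx
  nnu   : Name → NCtx → Proc → NCtx
  nch   : NCtx → Proc → NCtx

fillD : DCtx → Proc → Proc
fillD hole       R = R
fillD (dpar C P) R = fillD C R ∥ P
fillD (dnu x C P) R = ν x (fillD C R) P

fillN : NCtx → Proc → Proc
fillN nhole       R = R
fillN (npar N P)  R = fillN N R ∥ P
fillN (nnu x N P) R = ν x (fillN N R) P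
fillN (nch N P)   R = fillN N R ⊞ P

bnD : Name → DCtx → Set
bnD n hole        = ⊥
bnD n (dpar C P)  = bnD n C
bnD n (dnu x C P) = n ≡ x ⊎ bnD n C

big : (n : ℕ) → (Fin (suc n) → Proc) → Proc
big zero    f = f zero
big (suc n) f = f zero ⊞ big n (λ i → f (suc i))

opt : Proc → (m : ℕ) → (Fin m → Proc) → Proc
opt P zero    f = P
opt P (suc m) f = P ⊞ big m f

data Pfx : Set where
  p-out   : Name → Name → Pfx
  p-inp   : Name → Name → Pfx
  p-sel   : Name → Label → Pfx
  p-bra   : Name → Pfx
  p-close : Name → Pfx
  p-wait  : Name → Pfx
  p-some  : Name → Pfx
  p-none  : Name → Pfx
  p-exp   : Name → List Name → Pfx
  p-fwd   : Name → Name → Pfx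

data HasPfx : Proc → Pfx → Set where
  h-out   : ∀ {x y P Q} → HasPfx (out x y P Q) (p-out x y)
  h-inp   : ∀ {x y P} → HasPfx (inp x y P) (p-inp x y)
  h-sel   : ∀ {x l P} → HasPfx (sel x l P) (p-sel x l)
  h-bra   : ∀ {x bs} → HasPfx (bra x bs) (p-bra x)
  h-close : ∀ {x} → HasPfx (close x) (p-close x)
  h-wait  : ∀ {x P} → HasPfx (wait x P) (p-wait x)
  h-some  : ∀ {x P} → HasPfx (avail x P) (p-some x)
  h-none  : ∀ {x} → HasPfx (unavail x) (p-none x)
  h-exp   : ∀ {x ws P} → HasPfx (expect x ws P) (p-exp x ws)
  h-fwd   : ∀ {x y} → HasPfx [ x ↔ y ] (p-fwd x y)

-- sub(α) = {x}
SubjIs : Pfx → Name → Set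
SubjIs (p-out a _)   x = a ≡ x
SubjIs (p-inp a _)   x = a ≡ x
SubjIs (p-sel a _)   x = a ≡ x
SubjIs (p-bra a)     x = a ≡ x
SubjIs (p-close a)   x = a ≡ x
SubjIs (p-wait a)    x = a ≡ x
SubjIs (p-some a)    x = a ≡ x
SubjIs (p-none a)    x = a ≡ x
SubjIs (p-exp a _)   x = a ≡ x
SubjIs (p-fwd a b)   x = a ≡ x × b ≡ x

infix 4 _⋈_
data _⋈_ : Pfx → Pfx → Set where
  ⋈-out  : ∀ {x y z} → p-out x y ⋈ p-out x z
  ⋈-inp  : ∀ {x y z} → p-inp x y ⋈ p-inp x z
  ⋈-refl : ∀ {α} → α ⋈ α

data Pre1 (x : Name) : Proc → Proc → Set where
  pre1 : (n : ℕ) (C : Fin (suc n) → DCtx) (A : Fin (suc n) → Proc) (α : Fin (suc n) → Pfx)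
         (m : ℕ) (D : Fin m → DCtx) (B : Fin m → Proc) (β : Fin m → Pfx)
       → (∀ i → HasPfx (A i) (α i))
       → (∀ i i' → α i ⋈ α i')
       → (∀ i → SubjIs (α i) x)
       → (∀ j → HasPfx (B j) (β j))
       → (∀ i j → ¬ (α i ⋈ β j))
       → (∀ j → x ∈fn B j)
       → Pre1 x (opt (big n (λ i → fillD (C i) (A i))) m (λ j → fillD (D j) (B j)))
                (big n (λ i → fillD (C i) (A i)))

data Pre2 (x y : Name) : Proc → Proc → Set where
  pre2 : (n : ℕ) (C : Fin (suc n) → DCtx)
         (m : ℕ) (D : Fin m → DCtx) (z : Fin m → Name)
         (k : ℕ) (E : Fin k → DCtx) (A : Fin k → Proc) (α : Fin k → Pfx)
       → (∀ j → z j ≢ y)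
       → (∀ l → HasPfx (A l) (α l))
       → (∀ l → x ∈fn A l)
       → (∀ l z' → ¬ (α l ⋈ p-fwd x z'))
       → Pre2 x y (opt (opt (big n (λ i → fillD (C i) [ x ↔ y ]))
                            m (λ j → fillD (D j) [ x ↔ z j ]))
                       k (λ l → fillD (E l) (A l)))
                  (big n (λ i → fillD (C i) [ x ↔ y ]))

-- Reduction  P ⇝[ S ] Q   (S a finite set of names, given as a list)

_≐_ : List Name → List Name → Set
S ≐ T = ∀ n → (n ∈ S → n ∈ T) × (n ∈ T → n ∈ S)

nones : List Name → Proc
nones []           = 𝟎
nones (w ∷ [])     = unavail w
nones (w ∷ v ∷ ws) = unavail w ∥ nones (v ∷ ws)

infix 3 _⇝[_]_

data _⇝[_]_ : Proc → List Name → Proc → Set where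
  r-id : ∀ {x y Q Q'} (n : ℕ) (C : Fin (suc n) → DCtx)
       → Sub y x Q Q'
       → (∀ i → ¬ bnD x (C i))
       → (∀ i b → bnD b (C i) → b ∉fn Q)
       → ν x (big n (λ i → fillD (C i) [ x ↔ y ])) Q
           ⇝[ x ∷ y ∷ [] ] big n (λ i → fillD (C i) Q')

  r-comm : ∀ {x} (n : ℕ) (C : Fin (suc n) → DCtx) (y : Fin (suc n) → Name)
           (P Q P' : Fin (suc n) → Proc)
           (m : ℕ) (D : Fin (suc m) → DCtx) (z w : Name) (R R' : Fin (suc m) → Proc)
       → (∀ i → Sub w (y i) (P i) (P' i))
       → (∀ j → Sub w z (R j) (R' j))
       → (∀ i → ¬ bnD x (C i))
       → (∀ j → ¬ bnD x (D j))
       → (∀ i b → bnD b (C i) → b ∉fn big m (λ j → fillD (D j) (inp x z (R j))))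
       → (∀ i → w ∉fn P i)
       → (∀ j → ¬ bnD w (D j))
       → (∀ j → w ∉fn fillD (D j) (inp x z (R j)))
       → ν x (big n (λ i → fillD (C i) (out x (y i) (P i) (Q i))))
             (big m (λ j → fillD (D j) (inp x z (R j))))
           ⇝[ x ∷ [] ]
         big n (λ i → fillD (C i) (ν x (Q i) (ν w (P' i) (big m (λ j → fillD (D j) (R' j))))))

  r-sel : ∀ {x} (n : ℕ) (C : Fin (suc n) → DCtx) (P : Fin (suc n) → Proc)
          (m : ℕ) (D : Fin (suc m) → DCtx) (bs : Fin (suc m) → List (Label × Proc))
          (K : List Label) (k' : Label) (Q' : Fin (suc m) → Proc)
       → (∀ j → map proj₁ (bs j) ↭ K)
       → (∀ j → (k' , Q' j) ∈ bs j)
       → (∀ i → ¬ bnD x (C i))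
       → (∀ j → ¬ bnD x (D j))
       → ν x (big n (λ i → fillD (C i) (sel x k' (P i))))
             (big m (λ j → fillD (D j) (bra x (bs j))))
           ⇝[ x ∷ [] ]
         ν x (big n (λ i → fillD (C i) (P i))) (big m (λ j → fillD (D j) (Q' j)))

  r-close : ∀ {x} (n : ℕ) (C : Fin (suc n) → DCtx)
            (m : ℕ) (D : Fin (suc m) → DCtx) (Q : Fin (suc m) → Proc)
       → (∀ i → ¬ bnD x (C i))
       → (∀ j → ¬ bnD x (D j))
       → ν x (big n (λ i → fillD (C i) (close x)))
             (big m (λ j → fillD (D j) (wait x (Q j))))
           ⇝[ x ∷ [] ]
         (big n (λ i → fillD (C i) 𝟎) ∥ big m (λ j → fillD (D j) (Q j)))

  r-some : ∀ {x} (n : ℕ) (C : Fin (suc n) → DCtx) (P : Fin (suc n) → Proc)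
           (m : ℕ) (D : Fin (suc m) → DCtx) (ws : List Name) (Q : Fin (suc m) → Proc)
       → (∀ i → ¬ bnD x (C i))
       → (∀ j → ¬ bnD x (D j))
       → ν x (big n (λ i → fillD (C i) (avail x (P i))))
             (big m (λ j → fillD (D j) (expect x ws (Q j))))
           ⇝[ x ∷ [] ]
         ν x (big n (λ i → fillD (C i) (P i))) (big m (λ j → fillD (D j) (Q j)))

  r-none : ∀ {x} (n : ℕ) (C : Fin (suc n) → DCtx)
           (m : ℕ) (D : Fin (suc m) → DCtx) (ws : List Name) (Q : Fin (suc m) → Proc)
       → (∀ i → ¬ bnD x (C i))
       → (∀ j → ¬ bnD x (D j))
       → ν x (big n (λ i → fillD (C i) (unavail x)))
             (big m (λ j → fillD (D j) (expect x ws (Q j))))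
           ⇝[ x ∷ [] ]
         (big n (λ i → fillD (C i) 𝟎) ∥ big m (λ j → fillD (D j) (nones ws)))

  r-pre1 : ∀ {x S P Q P' Q' R}
       → S ≐ (x ∷ [])
       → Pre1 x P P' → Pre1 x Q Q'
       → ν x P' Q' ⇝[ S ] R
       → ν x P Q ⇝[ S ] R

  r-pre2 : ∀ {x y S P Q P' Q' R}
       → y ≢ x
       → S ≐ (x ∷ y ∷ [])
       → Pre2 x y P P' → Pre2 x y Q Q'
       → ν x P' Q' ⇝[ S ] R
       → ν x P Q ⇝[ S ] R

  r-ν⊞ : ∀ {x S P Q₁ Q₂ R} (N : NCtx) (C : DCtx)
       → ν x P (fillN N (fillD C Q₁ ⊞ fillD C Q₂)) ⇝[ S ] R
       → ν x P (fillN N (fillD C (Q₁ ⊞ Q₂))) ⇝[ S ] R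

  r-≡ : ∀ {S P P' Q Q'} → P ≡ₛ P' → P' ⇝[ S ] Q' → Q' ≡ₛ Q → P ⇝[ S ] Q
  r-ν : ∀ {x S P P' Q} → P ⇝[ S ] P' → ν x P Q ⇝[ S ] ν x P' Q
  r-∥ : ∀ {S P P' Q} → P ⇝[ S ] P' → (P ∥ Q) ⇝[ S ] (P' ∥ Q)
  r-⊞ : ∀ {S P P' Q} → P ⇝[ S ] P' → (P ⊞ Q) ⇝[ S ] (P' ⊞ Q)

infixr 7 _⊗_ _⅋_

data Ty : Set where
  𝟏   : Ty
  ⊥ₜ  : Ty
  _⊗_ : Ty → Ty → Ty
  _⅋_ : Ty → Ty → Ty
  ⊕ₗ  : List (Label × Ty) → Ty
  &ₗ  : List (Label × Ty) → Ty
  &₁  : Ty → Ty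
  ⊕₁  : Ty → Ty

mutual
  dual : Ty → Ty
  dual 𝟏        = ⊥ₜ
  dual ⊥ₜ       = 𝟏
  dual (A ⊗ B)  = dual A ⅋ dual B
  dual (A ⅋ B)  = dual A ⊗ dual B
  dual (⊕ₗ ts)  = &ₗ (dualL ts)
  dual (&ₗ ts)  = ⊕ₗ (dualL ts)
  dual (&₁ A)   = ⊕₁ (dual A)
  dual (⊕₁ A)   = &₁ (dual A)

  dualL : List (Label × Ty) → List (Label × Ty)
  dualL []             = []
  dualL ((l , A) ∷ ts) = (l , dual A) ∷ dualL ts

labels : ∀ {X : Set} → List (Label × X) → List Label
labels = map proj₁

-- Well-formed types: label-indexed families are represented by lists
-- with strictly increasing (hence distinct) labels (canonical form).
mutual
  WF : Ty → Set
  WF 𝟏       = ⊤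
  WF ⊥ₜ      = ⊤
  WF (A ⊗ B) = WF A × WF B
  WF (A ⅋ B) = WF A × WF B
  WF (⊕ₗ ts) = Linked _<_ (labels ts) × WFL ts
  WF (&ₗ ts) = Linked _<_ (labels ts) × WFL ts
  WF (&₁ A)  = WF A
  WF (⊕₁ A)  = WF A

  WFL : List (Label × Ty) → Set
  WFL []             = ⊤
  WFL ((l , A) ∷ ts) = WF A × WFL ts

-- Typing contexts: finite sets of assignments with distinct names,
-- represented as lists up to permutation (rule ⊢-exch).
Ctx : Set
Ctx = List (Name × Ty)

dom : Ctx → List Name
dom = map proj₁

Distinct : Ctx → Set
Distinct Γ = Unique (dom Γ)

AllWith : Ctx → Set
AllWith Γ = All (λ p → ∃ λ A' → proj₂ p ≡ &₁ A') Γ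

infix 3 _⊢_

mutual
  data _⊢_ : Proc → Ctx → Set where
    ⊢-cut  : ∀ {x A P Q Γ Δ} → P ⊢ (x , A) ∷ Γ → Q ⊢ (x , dual A) ∷ Δ
           → Distinct (Γ ++ Δ) → ν x P Q ⊢ Γ ++ Δ
    ⊢-mix  : ∀ {P Q Γ Δ} → P ⊢ Γ → Q ⊢ Δ → Distinct (Γ ++ Δ) → (P ∥ Q) ⊢ Γ ++ Δ
    ⊢-⊞    : ∀ {P Q Γ} → P ⊢ Γ → Q ⊢ Γ → (P ⊞ Q) ⊢ Γ
    ⊢-𝟎    : 𝟎 ⊢ []
    ⊢-fwd  : ∀ {x y A} → WF A → x ≢ y → [ x ↔ y ] ⊢ (x , A) ∷ (y , dual A) ∷ []
    ⊢-close : ∀ {x} → close x ⊢ (x , 𝟏) ∷ []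
    ⊢-wait : ∀ {x P Γ} → P ⊢ Γ → Distinct ((x , ⊥ₜ) ∷ Γ) → wait x P ⊢ (x , ⊥ₜ) ∷ Γ
    ⊢-out  : ∀ {x y A B P Q Γ Δ} → P ⊢ (y , A) ∷ Γ → Q ⊢ (x , B) ∷ Δ
           → Distinct ((x , A ⊗ B) ∷ Γ ++ Δ)
           → out x y P Q ⊢ (x , A ⊗ B) ∷ Γ ++ Δ
    ⊢-inp  : ∀ {x y A B P Γ} → P ⊢ (y , A) ∷ (x , B) ∷ Γ → inp x y P ⊢ (x , A ⅋ B) ∷ Γ
    ⊢-sel  : ∀ {x j A ts P Γ} → P ⊢ (x , A) ∷ Γ → (j , A) ∈ ts → WF (⊕ₗ ts)
           → sel x j P ⊢ (x , ⊕ₗ ts) ∷ Γ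
    ⊢-bra  : ∀ {x bs ts Γ} → BrTy x Γ bs ts → Linked _<_ (labels ts)
           → All (λ p → WF (proj₂ p)) Γ → Distinct ((x , &ₗ ts) ∷ Γ)
           → bra x bs ⊢ (x , &ₗ ts) ∷ Γ
    ⊢-some : ∀ {x A P Γ} → P ⊢ (x , A) ∷ Γ → avail x P ⊢ (x , &₁ A) ∷ Γ
    ⊢-none : ∀ {x A} → WF A → unavail x ⊢ (x , &₁ A) ∷ []
    ⊢-exp  : ∀ {x A ws P Γ} → P ⊢ (x , A) ∷ Γ → AllWith Γ → ws ↭ dom Γ
           → expect x ws P ⊢ (x , ⊕₁ A) ∷ Γ
    ⊢-exch : ∀ {P Γ Δ} → P ⊢ Γ → Γ ↭ Δ → P ⊢ Δ

  data BrTy (x : Name) (Γ : Ctx) : List (Label × Proc) → List (Label × Ty) → Set where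
    bt-[] : BrTy x Γ [] []
    bt-∷  : ∀ {l P A bs ts} → P ⊢ (x , A) ∷ Γ → BrTy x Γ bs ts
          → BrTy x Γ ((l , P) ∷ bs) ((l , A) ∷ ts)

{-# OPTIONS --safe #-}

-- The two sides of an outermost cut (νx)(L | M) have no free name but x.
-- Rule ν⊞ lifts the unguarded choices of L and of M up to this cut, so L and M
-- become choices among choice-free forests of cuts.  In such a forest every
-- component is ready on its subject (a forwarder on both of its names), so the
-- forest reduces unless it is ready on a free name: two prefixes that meet at a
-- cut interact, and a forwarder on a cut name fires Id.  As x is the only free
-- name, a summand that does not reduce is a prefix on x.  If no summand
-- reduces, all summands are prefixes on x, of dual types, and these interact
-- after ⪰ has discarded those that disagree with a chosen one.

module Submission where

open import Defs
open import Data.Empty using (⊥-elim)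
open import Data.Fin using (Fin; zero; suc)
open import Data.List using (List; []; _∷_; _++_; length; lookup)
open import Data.List.Membership.Propositional using (_∈_)
open import Data.List.Membership.Propositional.Properties
  using (∈-map⁺; ∈-map⁻; ∈-++⁺ˡ; ∈-++⁺ʳ)
open import Data.List.Properties using (≡-dec; ++-conicalˡ; ++-conicalʳ)
open import Data.List.Relation.Binary.Permutation.Propositional
  using (_↭_; ↭-reflexive; ↭-sym; ↭⇒↭ₛ)
open import Data.List.Relation.Binary.Permutation.Propositional.Properties
  using (∈-resp-↭; ↭-empty-inv; map⁺)
open import Data.List.Relation.Binary.Permutation.Setoid.Properties using (Unique-resp-↭)
open import Data.List.Relation.Unary.All as All using (All; []; _∷_)
open import Data.List.Relation.Unary.AllPairs using ([]; _∷_)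
open import Data.List.Relation.Unary.Any using (here; there)
open import Data.Nat using (ℕ; zero; suc; _≤_; _<_; _⊔_; _≟_)
open import Data.Nat.Properties
  using (≤-refl; ≤-trans; <⇒≢; m≤m⊔n; m≤n⊔m)
open import Data.Product using (Σ; _×_; _,_; proj₁; proj₂; ∃; ∃₂; ∃-syntax)
open import Data.Sum using (_⊎_; inj₁; inj₂)
open import Data.Unit using (⊤; tt)
open import Function using (_∘_)
open import Relation.Nullary using (Dec; ¬_; yes; no)
open import Relation.Binary.PropositionalEquality
  using (_≡_; _≢_; refl; sym; trans; cong; subst; ≢-sym; setoid)

-- Bound names and renaming

mutual
  -- Two instances are used: `_≢ y`, under which substituting `y` captures nothing, and `k ≤_`,
  -- which α-conversion can always arrange.
  AllBound : (Name → Set) → Proc → Set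
  AllBound X 𝟎               = ⊤
  AllBound X [ a ↔ b ]       = ⊤
  AllBound X (ν b P Q)       = X b × AllBound X P × AllBound X Q
  AllBound X (P ⊞ Q)         = AllBound X P × AllBound X Q
  AllBound X (out a b P Q)   = X b × AllBound X P × AllBound X Q
  AllBound X (inp a b P)     = X b × AllBound X P
  AllBound X (sel a l P)     = AllBound X P
  AllBound X (bra a bs)      = AllBoundBr X bs
  AllBound X (close a)       = ⊤
  AllBound X (wait a P)      = AllBound X P
  AllBound X (expect a ws P) = AllBound X P
  AllBound X (avail a P)     = AllBound X P
  AllBound X (unavail a)     = ⊤
  AllBound X (P ∥ Q)         = AllBound X P × AllBound X Q

  AllBoundBr : (Name → Set) → List (Label × Proc) → Set
  AllBoundBr X []             = ⊤
  AllBoundBr X ((l , P) ∷ bs) = AllBound X P × AllBoundBr X bs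

module _ {X Y : Name → Set} (f : ∀ {n} → X n → Y n) where
  mutual
    AllBound-map : ∀ P → AllBound X P → AllBound Y P
    AllBound-map 𝟎               _           = tt
    AllBound-map [ a ↔ b ]       _           = tt
    AllBound-map (ν b P Q)       (x , p , q) = f x , AllBound-map P p , AllBound-map Q q
    AllBound-map (P ⊞ Q)         (p , q)     = AllBound-map P p , AllBound-map Q q
    AllBound-map (out a b P Q)   (x , p , q) = f x , AllBound-map P p , AllBound-map Q q
    AllBound-map (inp a b P)     (x , p)     = f x , AllBound-map P p
    AllBound-map (sel a l P)     p           = AllBound-map P p
    AllBound-map (bra a bs)      ps          = AllBoundBr-map bs ps
    AllBound-map (close a)       _           = tt
    AllBound-map (wait a P)      p           = AllBound-map P p
    AllBound-map (expect a ws P) p           = AllBound-map P p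
    AllBound-map (avail a P)     p           = AllBound-map P p
    AllBound-map (unavail a)     _           = tt
    AllBound-map (P ∥ Q)         (p , q)     = AllBound-map P p , AllBound-map Q q

    AllBoundBr-map : ∀ bs → AllBoundBr X bs → AllBoundBr Y bs
    AllBoundBr-map []             _        = tt
    AllBoundBr-map ((l , P) ∷ bs) (p , ps) = AllBound-map P p , AllBoundBr-map bs ps

mutual
  Sub-AllBound : ∀ {X y z P P'} → Sub y z P P' → AllBound X P → AllBound X P'
  Sub-AllBound s-0             _           = tt
  Sub-AllBound s-fwd           _           = tt
  Sub-AllBound s-ν-bound       b           = b
  Sub-AllBound (s-ν _ _ s t)   (x , p , q) = x , Sub-AllBound s p , Sub-AllBound t q
  Sub-AllBound (s-⊞ s t)       (p , q)     = Sub-AllBound s p , Sub-AllBound t q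
  Sub-AllBound (s-out-bound t) (x , p , q) = x , p , Sub-AllBound t q
  Sub-AllBound (s-out _ _ s t) (x , p , q) = x , Sub-AllBound s p , Sub-AllBound t q
  Sub-AllBound s-inp-bound     b           = b
  Sub-AllBound (s-inp _ _ s)   (x , p)     = x , Sub-AllBound s p
  Sub-AllBound (s-sel s)       p           = Sub-AllBound s p
  Sub-AllBound (s-bra ss)      ps          = SubBr-AllBound ss ps
  Sub-AllBound s-close         _           = tt
  Sub-AllBound (s-wait s)      p           = Sub-AllBound s p
  Sub-AllBound (s-exp s)       p           = Sub-AllBound s p
  Sub-AllBound (s-avail s)     p           = Sub-AllBound s p
  Sub-AllBound s-unavail       _           = tt
  Sub-AllBound (s-∥ s t)       (p , q)     = Sub-AllBound s p , Sub-AllBound t q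

  SubBr-AllBound : ∀ {X y z bs bs'} → SubBr y z bs bs' → AllBoundBr X bs → AllBoundBr X bs'
  SubBr-AllBound sb-[]       _        = tt
  SubBr-AllBound (sb-∷ s ss) (p , ps) = Sub-AllBound s p , SubBr-AllBound ss ps

module _ {y : Name} (z : Name) where
  mutual
    -- Capture is the only way for `Sub` to be undefined. A binder equal to `z` shields its scope,
    -- which is then left as it is.
    Sub-total : ∀ P → AllBound (_≢ y) P → ∃ (Sub y z P)
    Sub-total 𝟎         _ = _ , s-0
    Sub-total [ a ↔ b ] _ = _ , s-fwd
    Sub-total (ν b P Q) (b≢y , p , q) with b ≟ z
    ... | yes refl = _ , s-ν-bound
    ... | no b≢z   = _ , s-ν b≢z b≢y (proj₂ (Sub-total P p)) (proj₂ (Sub-total Q q))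
    Sub-total (P ⊞ Q) (p , q) = _ , s-⊞ (proj₂ (Sub-total P p)) (proj₂ (Sub-total Q q))
    Sub-total (out a b P Q) (b≢y , p , q) with b ≟ z
    ... | yes refl = _ , s-out-bound (proj₂ (Sub-total Q q))
    ... | no b≢z   = _ , s-out b≢z b≢y (proj₂ (Sub-total P p)) (proj₂ (Sub-total Q q))
    Sub-total (inp a b P) (b≢y , p) with b ≟ z
    ... | yes refl = _ , s-inp-bound
    ... | no b≢z   = _ , s-inp b≢z b≢y (proj₂ (Sub-total P p))
    Sub-total (sel a l P)     p       = _ , s-sel (proj₂ (Sub-total P p))
    Sub-total (bra a bs)      ps      = _ , s-bra (proj₂ (SubBr-total bs ps))
    Sub-total (close a)       _       = _ , s-close
    Sub-total (wait a P)      p       = _ , s-wait (proj₂ (Sub-total P p))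
    Sub-total (expect a ws P) p       = _ , s-exp (proj₂ (Sub-total P p))
    Sub-total (avail a P)     p       = _ , s-avail (proj₂ (Sub-total P p))
    Sub-total (unavail a)     _       = _ , s-unavail
    Sub-total (P ∥ Q)         (p , q) = _ , s-∥ (proj₂ (Sub-total P p)) (proj₂ (Sub-total Q q))

    SubBr-total : ∀ bs → AllBoundBr (_≢ y) bs → ∃ (SubBr y z bs)
    SubBr-total []             _        = _ , sb-[]
    SubBr-total ((l , P) ∷ bs) (p , ps) =
      _ , sb-∷ (proj₂ (Sub-total P p)) (proj₂ (SubBr-total bs ps))

-- Numeric bounds on the names of a process

mutual
  -- Free and bound names are bounded together, so that `k` itself is at once not free and not a
  -- binder.
  Below : ℕ → Proc → Set
  Below k 𝟎               = ⊤
  Below k [ a ↔ b ]       = a < k × b < k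
  Below k (ν b P Q)       = b < k × Below k P × Below k Q
  Below k (P ⊞ Q)         = Below k P × Below k Q
  Below k (out a b P Q)   = a < k × b < k × Below k P × Below k Q
  Below k (inp a b P)     = a < k × b < k × Below k P
  Below k (sel a l P)     = a < k × Below k P
  Below k (bra a bs)      = a < k × BelowBr k bs
  Below k (close a)       = a < k
  Below k (wait a P)      = a < k × Below k P
  Below k (expect a ws P) = a < k × All (_< k) ws × Below k P
  Below k (avail a P)     = a < k × Below k P
  Below k (unavail a)     = a < k
  Below k (P ∥ Q)         = Below k P × Below k Q

  BelowBr : ℕ → List (Label × Proc) → Set
  BelowBr k []             = ⊤
  BelowBr k ((l , P) ∷ bs) = Below k P × BelowBr k bs

module _ {k k' : ℕ} (k≤k' : k ≤ k') where
  private
    up : ∀ {a} → a < k → a < k'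
    up a<k = ≤-trans a<k k≤k'

  mutual
    Below-mono : ∀ P → Below k P → Below k' P
    Below-mono 𝟎               _               = tt
    Below-mono [ a ↔ b ]       (x , y)         = up x , up y
    Below-mono (ν b P Q)       (x , p , q)     = up x , Below-mono P p , Below-mono Q q
    Below-mono (P ⊞ Q)         (p , q)         = Below-mono P p , Below-mono Q q
    Below-mono (out a b P Q)   (x , y , p , q) = up x , up y , Below-mono P p , Below-mono Q q
    Below-mono (inp a b P)     (x , y , p)     = up x , up y , Below-mono P p
    Below-mono (sel a l P)     (x , p)         = up x , Below-mono P p
    Below-mono (bra a bs)      (x , ps)        = up x , BelowBr-mono bs ps
    Below-mono (close a)       x               = up x
    Below-mono (wait a P)      (x , p)         = up x , Below-mono P p
    Below-mono (expect a ws P) (x , xs , p)    = up x , All.map up xs , Below-mono P p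
    Below-mono (avail a P)     (x , p)         = up x , Below-mono P p
    Below-mono (unavail a)     x               = up x
    Below-mono (P ∥ Q)         (p , q)         = Below-mono P p , Below-mono Q q

    BelowBr-mono : ∀ bs → BelowBr k bs → BelowBr k' bs
    BelowBr-mono []             _        = tt
    BelowBr-mono ((l , P) ∷ bs) (p , ps) = Below-mono P p , BelowBr-mono bs ps

bound-name : ∀ k a → ∃[ k' ] (k ≤ k' × a < k')
bound-name k a = k ⊔ suc a , m≤m⊔n k (suc a) , m≤n⊔m k (suc a)

bound-names : ∀ k as → ∃[ k' ] (k ≤ k' × All (_< k') as)
bound-names k [] = k , ≤-refl , []
bound-names k (a ∷ as) with bound-name k a
... | k₁ , k≤k₁ , a<k₁ with bound-names k₁ as
... | k₂ , k₁≤k₂ , as<k₂ = k₂ , ≤-trans k≤k₁ k₁≤k₂ , ≤-trans a<k₁ k₁≤k₂ ∷ as<k₂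

mutual
  -- Starting from a given `k` makes bounds composable: each result dominates the earlier ones, so
  -- earlier facts carry over by monotonicity.
  bound : ∀ k P → ∃[ k' ] (k ≤ k' × Below k' P)
  bound k 𝟎               = k , ≤-refl , tt
  bound k [ a ↔ b ] with bound-names k (a ∷ b ∷ [])
  ... | k' , le , x ∷ y ∷ [] = k' , le , x , y
  bound k (ν b P Q) with bound-name k b
  ... | k₁ , le₁ , x with bound-two k₁ P Q
  ... | k₂ , le₂ , r = k₂ , ≤-trans le₁ le₂ , ≤-trans x le₂ , r
  bound k (P ⊞ Q)         = bound-two k P Q
  bound k (out a b P Q) with bound-names k (a ∷ b ∷ [])
  ... | k₁ , le₁ , x ∷ y ∷ [] with bound-two k₁ P Q
  ... | k₂ , le₂ , r = k₂ , ≤-trans le₁ le₂ , ≤-trans x le₂ , ≤-trans y le₂ , r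
  bound k (inp a b P) with bound-name k a
  ... | k₁ , le₁ , x with bound-with k₁ b P
  ... | k₂ , le₂ , r = k₂ , ≤-trans le₁ le₂ , ≤-trans x le₂ , r
  bound k (sel a l P)     = bound-with k a P
  bound k (bra a bs) with bound-name k a
  ... | k₁ , le₁ , x with bound-br k₁ bs
  ... | k₂ , le₂ , r = k₂ , ≤-trans le₁ le₂ , ≤-trans x le₂ , r
  bound k (close a)       = bound-name k a
  bound k (wait a P)      = bound-with k a P
  bound k (expect a ws P) with bound-names k (a ∷ ws)
  ... | k₁ , le₁ , x ∷ xs with bound k₁ P
  ... | k₂ , le₂ , p =
    k₂ , ≤-trans le₁ le₂ , ≤-trans x le₂ , All.map (λ y → ≤-trans y le₂) xs , p
  bound k (avail a P)     = bound-with k a P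
  bound k (unavail a)     = bound-name k a
  bound k (P ∥ Q)         = bound-two k P Q

  bound-with : ∀ k a P → ∃[ k' ] (k ≤ k' × a < k' × Below k' P)
  bound-with k a P with bound-name k a
  ... | k₁ , le₁ , x with bound k₁ P
  ... | k₂ , le₂ , p = k₂ , ≤-trans le₁ le₂ , ≤-trans x le₂ , p

  bound-two : ∀ k P Q → ∃[ k' ] (k ≤ k' × Below k' P × Below k' Q)
  bound-two k P Q with bound k P
  ... | k₁ , le₁ , p with bound k₁ Q
  ... | k₂ , le₂ , q = k₂ , ≤-trans le₁ le₂ , Below-mono le₂ P p , q

  bound-br : ∀ k bs → ∃[ k' ] (k ≤ k' × BelowBr k' bs)
  bound-br k []             = k , ≤-refl , tt
  bound-br k ((l , P) ∷ bs) with bound k P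
  ... | k₁ , le₁ , p with bound-br k₁ bs
  ... | k₂ , le₂ , ps = k₂ , ≤-trans le₁ le₂ , Below-mono le₂ P p , ps

module _ {k : ℕ} where
  mutual
    Below⇒∉fn : ∀ {n P} → Below k P → k ≤ n → n ∉fn P
    Below⇒∉fn {P = P} below k≤n n∈P = <⇒≢ (≤-trans (fn⇒< P below n∈P) k≤n) refl

    fn⇒< : ∀ {n} P → Below k P → n ∈fn P → n < k
    fn⇒< _ (x , y)         fn-fwdˡ        = x
    fn⇒< _ (x , y)         fn-fwdʳ        = y
    fn⇒< _ (x , p , q)     (fn-νˡ _ i)    = fn⇒< _ p i
    fn⇒< _ (x , p , q)     (fn-νʳ _ i)    = fn⇒< _ q i
    fn⇒< _ (p , q)         (fn-⊞ˡ i)      = fn⇒< _ p i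
    fn⇒< _ (p , q)         (fn-⊞ʳ i)      = fn⇒< _ q i
    fn⇒< _ (x , _)         fn-out-sub     = x
    fn⇒< _ (x , y , p , q) (fn-out-P _ i) = fn⇒< _ p i
    fn⇒< _ (x , y , p , q) (fn-out-Q i)   = fn⇒< _ q i
    fn⇒< _ (x , _)         fn-inp-sub     = x
    fn⇒< _ (x , y , p)     (fn-inp-P _ i) = fn⇒< _ p i
    fn⇒< _ (x , _)         fn-sel-sub     = x
    fn⇒< _ (x , p)         (fn-sel-P i)   = fn⇒< _ p i
    fn⇒< _ (x , _)         fn-bra-sub     = x
    fn⇒< _ (x , ps)        (fn-bra-P m i) = fnBr⇒< _ ps m i
    fn⇒< _ x               fn-close       = x
    fn⇒< _ (x , _)         fn-wait-sub    = x
    fn⇒< _ (x , p)         (fn-wait-P i)  = fn⇒< _ p i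
    fn⇒< _ (x , _)         fn-exp-sub     = x
    fn⇒< _ (x , xs , p)    (fn-exp-ws m)  = All.lookup xs m
    fn⇒< _ (x , xs , p)    (fn-exp-P i)   = fn⇒< _ p i
    fn⇒< _ (x , _)         fn-avail-sub   = x
    fn⇒< _ (x , p)         (fn-avail-P i) = fn⇒< _ p i
    fn⇒< _ x               fn-unavail     = x
    fn⇒< _ (p , q)         (fn-∥ˡ i)      = fn⇒< _ p i
    fn⇒< _ (p , q)         (fn-∥ʳ i)      = fn⇒< _ q i

    fnBr⇒< : ∀ {n l P} bs → BelowBr k bs → (l , P) ∈ bs → n ∈fn P → n < k
    fnBr⇒< _ (p , ps) (here refl) i = fn⇒< _ p i
    fnBr⇒< _ (p , ps) (there m)   i = fnBr⇒< _ ps m i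

  mutual
    Below⇒AllBound : ∀ P → Below k P → AllBound (_≢ k) P
    Below⇒AllBound 𝟎               _               = tt
    Below⇒AllBound [ a ↔ b ]       _               = tt
    Below⇒AllBound (ν b P Q)       (x , p , q)     = <⇒≢ x , Below⇒AllBound P p , Below⇒AllBound Q q
    Below⇒AllBound (P ⊞ Q)         (p , q)         = Below⇒AllBound P p , Below⇒AllBound Q q
    Below⇒AllBound (out a b P Q)   (_ , x , p , q) = <⇒≢ x , Below⇒AllBound P p , Below⇒AllBound Q q
    Below⇒AllBound (inp a b P)     (_ , x , p)     = <⇒≢ x , Below⇒AllBound P p
    Below⇒AllBound (sel a l P)     (_ , p)         = Below⇒AllBound P p
    Below⇒AllBound (bra a bs)      (_ , ps)        = BelowBr⇒AllBoundBr bs ps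
    Below⇒AllBound (close a)       _               = tt
    Below⇒AllBound (wait a P)      (_ , p)         = Below⇒AllBound P p
    Below⇒AllBound (expect a ws P) (_ , _ , p)     = Below⇒AllBound P p
    Below⇒AllBound (avail a P)     (_ , p)         = Below⇒AllBound P p
    Below⇒AllBound (unavail a)     _               = tt
    Below⇒AllBound (P ∥ Q)         (p , q)         = Below⇒AllBound P p , Below⇒AllBound Q q

    BelowBr⇒AllBoundBr : ∀ bs → BelowBr k bs → AllBoundBr (_≢ k) bs
    BelowBr⇒AllBoundBr []             _        = tt
    BelowBr⇒AllBoundBr ((l , P) ∷ bs) (p , ps) = Below⇒AllBound P p , BelowBr⇒AllBoundBr bs ps

  rename : ∀ z P → Below k P → ∃ (Sub k z P)
  rename z P p = Sub-total z P (Below⇒AllBound P p)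

-- Moving all binders above a bound by α-conversion

module _ (k : ℕ) where
  mutual
    -- Works from the inside out: once the bodies are freshened, a bound `b'` on their names becomes
    -- the new binder. It is at least `k` and occurs nowhere in its scope, so the α-step captures
    -- nothing.
    freshen : ∀ P → ∃[ P' ] (P ≡ₛ P' × AllBound (k ≤_) P')
    freshen 𝟎         = _ , ≡-refl , tt
    freshen [ a ↔ b ] = _ , ≡-refl , tt
    freshen (ν b P Q) with freshen P | freshen Q
    ... | P₁ , eqP , p | Q₁ , eqQ , q with bound-two k P₁ Q₁
    ... | b' , k≤b' , belowP , belowQ with rename b P₁ belowP | rename b Q₁ belowQ
    ... | _ , s | _ , t =
      _ , ≡-trans (c-ν eqP eqQ) (α-ν (Below⇒∉fn belowP ≤-refl) (Below⇒∉fn belowQ ≤-refl) s t)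
        , k≤b' , Sub-AllBound s p , Sub-AllBound t q
    freshen (P ⊞ Q) with freshen P | freshen Q
    ... | _ , eqP , p | _ , eqQ , q = _ , c-⊞ eqP eqQ , p , q
    freshen (out a b P Q) with freshen P | freshen Q
    ... | P₁ , eqP , p | Q₁ , eqQ , q with bound k P₁
    ... | b' , k≤b' , belowP with rename b P₁ belowP
    ... | _ , s =
      _ , ≡-trans (c-out eqP eqQ) (α-out (Below⇒∉fn belowP ≤-refl) s)
        , k≤b' , Sub-AllBound s p , q
    freshen (inp a b P) with freshen P
    ... | P₁ , eqP , p with bound k P₁
    ... | b' , k≤b' , belowP with rename b P₁ belowP
    ... | _ , s =
      _ , ≡-trans (c-inp eqP) (α-inp (Below⇒∉fn belowP ≤-refl) s) , k≤b' , Sub-AllBound s p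
    freshen (sel a l P) with freshen P
    ... | _ , eqP , p = _ , c-sel eqP , p
    freshen (bra a bs) with freshenBr bs
    ... | _ , eqs , ps = _ , c-bra eqs , ps
    freshen (close a) = _ , ≡-refl , tt
    freshen (wait a P) with freshen P
    ... | _ , eqP , p = _ , c-wait eqP , p
    freshen (expect a ws P) with freshen P
    ... | _ , eqP , p = _ , c-exp eqP , p
    freshen (avail a P) with freshen P
    ... | _ , eqP , p = _ , c-avail eqP , p
    freshen (unavail a) = _ , ≡-refl , tt
    freshen (P ∥ Q) with freshen P | freshen Q
    ... | _ , eqP , p | _ , eqQ , q = _ , c-∥ eqP eqQ , p , q

    freshenBr : ∀ bs → ∃[ bs' ] (BrEq bs bs' × AllBoundBr (k ≤_) bs')
    freshenBr [] = _ , be-[] , tt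
    freshenBr ((l , P) ∷ bs) with freshen P | freshenBr bs
    ... | _ , eqP , p | _ , eqs , ps = _ , be-∷ eqP eqs , p , ps

-- Readiness

-- `bnD` sees only the binders on the path to the hole, the ones that can capture names of what is
-- put there.
FreshD : ℕ → DCtx → Set
FreshD k C = ∀ b → bnD b C → k ≤ b

record Item (X : Proc → Set) (k : ℕ) : Set where
  constructor item
  field
    ctx   : DCtx
    fresh : FreshD k ctx
    body  : Proc
    ready : X body

open Item

proc : ∀ {X k} → Item X k → Proc
proc i = fillD (ctx i) (body i)

-- Asking for binders above an arbitrary k builds α-conversion into readiness.
Ready : (Proc → Set) → Proc → Set
Ready X T = ∀ k → Σ (Item X k) λ i → T ≡ₛ proc i

Ready-here : ∀ {X : Proc → Set} {P} → X P → Ready X P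
Ready-here x k = item hole (λ _ ()) _ x , ≡-refl

Ready-≡ : ∀ {X T T'} → T ≡ₛ T' → Ready X T' → Ready X T
Ready-≡ eq r k with r k
... | i , eq' = i , ≡-trans eq eq'

Ready-∥ : ∀ {X T U} → Ready X T → Ready X (T ∥ U)
Ready-∥ {U = U} r k with r k
... | item C fr P x , eq = item (dpar C U) fr P x , c-∥ eq ≡-refl

-- All binders of `C` exceed `z`, so none of them shields the hole: the substitution reaches the
-- body, and the context gains no binder.
Sub-fillD : ∀ {y z A A'} C → FreshD (suc z) C → AllBound (_≢ y) (fillD C A) → Sub y z A A'
  → ∃[ C' ] (Sub y z (fillD C A) (fillD C' A') × (∀ b → bnD b C' → bnD b C))
Sub-fillD hole fr _ s = hole , s , λ _ ()
Sub-fillD {z = z} (dpar C P) fr (c , p) s with Sub-fillD C fr c s | Sub-total z P p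
... | C' , sC , sub | P' , sP = dpar C' P' , s-∥ sC sP , sub
Sub-fillD {z = z} (dnu b C P) fr (b≢y , c , p) s
  with Sub-fillD C (λ n i → fr n (inj₂ i)) c s | Sub-total z P p
... | C' , sC , sub | P' , sP =
  dnu b C' P' , s-ν (≢-sym (<⇒≢ (fr b (inj₁ refl)))) b≢y sC sP
  , λ { n (inj₁ e) → inj₁ e ; n (inj₂ i) → inj₂ (sub n i) }

-- Only `z` is fixed in advance; the fresh name `y` that replaces it is found later, when a cut on
-- `z` is α-converted.
Stable : Name → (Proc → Set) → Set
Stable z X = ∀ {y P P'} → Sub y z P P' → X P → X P'

Below-body : ∀ {k A} C → Below k (fillD C A) → Below k A
Below-body hole        p           = p
Below-body (dpar C P)  (c , _)     = Below-body C c
Below-body (dnu b C P) (_ , c , _) = Below-body C c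

Below-ctx : ∀ {k A} C → Below k (fillD C A) → ∀ b → bnD b C → b < k
Below-ctx (dpar C P)  (c , _)     n i           = Below-ctx C c n i
Below-ctx (dnu b C P) (x , _)     n (inj₁ refl) = x
Below-ctx (dnu b C P) (_ , c , _) n (inj₂ i)    = Below-ctx C c n i

-- The cut adds its own binder `z`, which may lie below `k`; it is α-converted to a large name `b`.
-- Stability keeps the body ready after the renaming.
Ready-ν : ∀ {X z T U} → Stable z X → Ready X T → Ready X (ν z T U)
-- The maximum serves two ends: binders from `k` on, as required, and above `z`, so that the
-- renaming can pass them.
Ready-ν {z = z} {T} {U} stable r k with r (k ⊔ suc z)
... | item C fr A x , eq with bound-two k (fillD C A) U
... | b , k≤b , belowC , belowU
  with rename z A (Below-body C belowC) | rename z U belowU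
... | A' , sA | U' , sU
  with Sub-fillD C (λ n i → ≤-trans (m≤n⊔m k (suc z)) (fr n i)) (Below⇒AllBound _ belowC) sA
... | C' , sC , sub =
  item (dnu b C' U')
       (λ { n (inj₁ refl) → k≤b ; n (inj₂ i) → ≤-trans (m≤m⊔n k (suc z)) (fr n (sub n i)) })
       A' (stable sA x)
  , ≡-trans (c-ν eq ≡-refl) (α-ν (Below⇒∉fn belowC ≤-refl) (Below⇒∉fn belowU ≤-refl) sC sU)

-- Keeps just what an interaction needs from typing: the shape of the prefix and, for labelled
-- types, the labels. Continuations are left unconstrained.
data Pre (x : Name) : Ty → Proc → Set where
  pre-close : Pre x 𝟏 (close x)
  pre-wait  : ∀ {P} → Pre x ⊥ₜ (wait x P)
  pre-out   : ∀ {A B y P Q} → Pre x (A ⊗ B) (out x y P Q)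
  pre-inp   : ∀ {A B y P} → Pre x (A ⅋ B) (inp x y P)
  pre-sel   : ∀ {ts l P} → l ∈ labels ts → Pre x (⊕ₗ ts) (sel x l P)
  pre-bra   : ∀ {ts bs} → labels bs ≡ labels ts → Pre x (&ₗ ts) (bra x bs)
  pre-some  : ∀ {A P} → Pre x (&₁ A) (avail x P)
  pre-none  : ∀ {A} → Pre x (&₁ A) (unavail x)
  pre-exp   : ∀ {A ws P} → Pre x (⊕₁ A) (expect x ws P)

data Fwd (x y : Name) : Proc → Set where
  fwd : Fwd x y [ x ↔ y ]

ren-≢ : ∀ {y z x} → x ≢ z → ren y z x ≡ x
ren-≢ {z = z} {x} x≢z with x ≟ z
... | yes x≡z = ⊥-elim (x≢z x≡z)
... | no  _   = refl

SubBr-labels : ∀ {y z bs bs'} → SubBr y z bs bs' → labels bs' ≡ labels bs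
SubBr-labels sb-[]       = refl
SubBr-labels (sb-∷ _ ss) = cong (_ ∷_) (SubBr-labels ss)

Pre-stable : ∀ {x z A} → x ≢ z → Stable z (Pre x A)
Pre-stable x≢z {y} s p with ren-≢ {y} x≢z
Pre-stable x≢z s-close           pre-close   | e rewrite e = pre-close
Pre-stable x≢z (s-wait _)        pre-wait    | e rewrite e = pre-wait
Pre-stable x≢z (s-out-bound _)   pre-out     | e rewrite e = pre-out
Pre-stable x≢z (s-out _ _ _ _)   pre-out     | e rewrite e = pre-out
Pre-stable x≢z s-inp-bound       pre-inp     | e rewrite e = pre-inp
Pre-stable x≢z (s-inp _ _ _)     pre-inp     | e rewrite e = pre-inp
Pre-stable x≢z (s-sel _)         (pre-sel m) | e rewrite e = pre-sel m
Pre-stable x≢z (s-bra ss)        (pre-bra q) | e rewrite e = pre-bra (trans (SubBr-labels ss) q)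
Pre-stable x≢z (s-avail _)       pre-some    | e rewrite e = pre-some
Pre-stable x≢z s-unavail         pre-none    | e rewrite e = pre-none
Pre-stable x≢z (s-exp _)         pre-exp     | e rewrite e = pre-exp

Fwd-stable : ∀ {x y z} → x ≢ z → y ≢ z → Stable z (Fwd x y)
Fwd-stable x≢z y≢z {w} s-fwd fwd rewrite ren-≢ {w} x≢z | ren-≢ {w} y≢z = fwd

pfx : ∀ {x A P} → Pre x A P → Pfx
pfx {x} pre-close            = p-close x
pfx {x} pre-wait             = p-wait x
pfx {x} (pre-out {y = y})    = p-out x y
pfx {x} (pre-inp {y = y})    = p-inp x y
pfx {x} (pre-sel {l = l} _)  = p-sel x l
pfx {x} (pre-bra _)          = p-bra x
pfx {x} pre-some             = p-some x
pfx {x} pre-none             = p-none x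
pfx {x} (pre-exp {ws = ws})  = p-exp x ws

Pre⇒HasPfx : ∀ {x A P} (p : Pre x A P) → HasPfx P (pfx p)
Pre⇒HasPfx pre-close   = h-close
Pre⇒HasPfx pre-wait    = h-wait
Pre⇒HasPfx pre-out     = h-out
Pre⇒HasPfx pre-inp     = h-inp
Pre⇒HasPfx (pre-sel _) = h-sel
Pre⇒HasPfx (pre-bra _) = h-bra
Pre⇒HasPfx pre-some    = h-some
Pre⇒HasPfx pre-none    = h-none
Pre⇒HasPfx pre-exp     = h-exp

Pre⇒SubjIs : ∀ {x A P} (p : Pre x A P) → SubjIs (pfx p) x
Pre⇒SubjIs pre-close   = refl
Pre⇒SubjIs pre-wait    = refl
Pre⇒SubjIs pre-out     = refl
Pre⇒SubjIs pre-inp     = refl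
Pre⇒SubjIs (pre-sel _) = refl
Pre⇒SubjIs (pre-bra _) = refl
Pre⇒SubjIs pre-some    = refl
Pre⇒SubjIs pre-none    = refl
Pre⇒SubjIs pre-exp     = refl

Pre⇒∈fn : ∀ {x A P} → Pre x A P → x ∈fn P
Pre⇒∈fn pre-close   = fn-close
Pre⇒∈fn pre-wait    = fn-wait-sub
Pre⇒∈fn pre-out     = fn-out-sub
Pre⇒∈fn pre-inp     = fn-inp-sub
Pre⇒∈fn (pre-sel _) = fn-sel-sub
Pre⇒∈fn (pre-bra _) = fn-bra-sub
Pre⇒∈fn pre-some    = fn-avail-sub
Pre⇒∈fn pre-none    = fn-unavail
Pre⇒∈fn pre-exp     = fn-exp-sub

⋈-sym : ∀ {α β} → α ⋈ β → β ⋈ α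
⋈-sym ⋈-out  = ⋈-out
⋈-sym ⋈-inp  = ⋈-inp
⋈-sym ⋈-refl = ⋈-refl

⋈-trans : ∀ {α β γ} → α ⋈ β → β ⋈ γ → α ⋈ γ
⋈-trans ⋈-refl q      = q
⋈-trans ⋈-out  ⋈-out  = ⋈-out
⋈-trans ⋈-out  ⋈-refl = ⋈-out
⋈-trans ⋈-inp  ⋈-inp  = ⋈-inp
⋈-trans ⋈-inp  ⋈-refl = ⋈-inp

pfx-⋈? : ∀ {x A P Q} (p : Pre x A P) (q : Pre x A Q) → Dec (pfx p ⋈ pfx q)
pfx-⋈? pre-close   pre-close   = yes ⋈-refl
pfx-⋈? pre-wait    pre-wait    = yes ⋈-refl
pfx-⋈? pre-out     pre-out     = yes ⋈-out
pfx-⋈? pre-inp     pre-inp     = yes ⋈-inp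
pfx-⋈? (pre-sel {l = l} _) (pre-sel {l = l'} _) with l ≟ l'
... | yes refl = yes ⋈-refl
... | no l≢l'  = no λ { ⋈-refl → l≢l' refl }
pfx-⋈? (pre-bra _) (pre-bra _) = yes ⋈-refl
pfx-⋈? pre-some    pre-some    = yes ⋈-refl
pfx-⋈? pre-some    pre-none    = no λ ()
pfx-⋈? pre-none    pre-some    = no λ ()
pfx-⋈? pre-none    pre-none    = yes ⋈-refl
pfx-⋈? (pre-exp {ws = ws}) (pre-exp {ws = ws'}) with ≡-dec _≟_ ws ws'
... | yes refl = yes ⋈-refl
... | no ws≢   = no λ { ⋈-refl → ws≢ refl }

-- Choices as lists of summands

≡⇒≡ₛ : ∀ {P Q} → P ≡ Q → P ≡ₛ Q
≡⇒≡ₛ refl = ≡-refl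

big-cong : ∀ n {f g : Fin (suc n) → Proc} → (∀ i → f i ≡ₛ g i) → big n f ≡ₛ big n g
big-cong zero    e = e zero
big-cong (suc n) e = c-⊞ (e zero) (big-cong n (e ∘ suc))

data Choice (X : Proc → Set) : Proc → Set where
  one  : ∀ {P} → X P → Choice X P
  _or_ : ∀ {P Q} → Choice X P → Choice X Q → Choice X (P ⊞ Q)

Choice-map : ∀ {X Y : Proc → Set} {P} → (∀ {T} → X T → Y T) → Choice X P → Choice Y P
Choice-map f (one x)  = one (f x)
Choice-map f (c or d) = Choice-map f c or Choice-map f d

module _ {X : Proc → Set} {k : ℕ} where
  choice : Item X k → List (Item X k) → Proc
  choice i is = big (length is) (λ j → proc (lookup (i ∷ is) j))

  -- Mirrors the shape that `Pre1` demands, where the summands to be discarded form a possibly empty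
  -- tail.
  extend : Proc → List (Item X k) → Proc
  extend P is = opt P (length is) (λ j → proc (lookup is j))

  choice-++ : ∀ i is j js → choice i is ⊞ choice j js ≡ₛ choice i (is ++ j ∷ js)
  choice-++ i []        j js = ≡-refl
  choice-++ i (i' ∷ is) j js = ≡-trans ⊞-assoc (c-⊞ ≡-refl (choice-++ i' is j js))

  choice-extend : ∀ i is → choice i is ≡ extend (proc i) is
  choice-extend i []       = refl
  choice-extend i (_ ∷ is) = refl

  extend-cong : ∀ {P Q} is → P ≡ₛ Q → extend P is ≡ₛ extend Q is
  extend-cong []       e = e
  extend-cong (_ ∷ is) e = c-⊞ e ≡-refl

  extend-⊞ : ∀ {P Q} is → extend (P ⊞ Q) is ≡ₛ extend P is ⊞ Q
  extend-⊞ []       = ≡-refl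
  extend-⊞ (_ ∷ is) = ≡-trans ⊞-assoc (≡-trans (c-⊞ ≡-refl ⊞-comm) (≡-sym ⊞-assoc))

  extend-∷ : ∀ {P} i is → extend P (i ∷ is) ≡ₛ extend (P ⊞ proc i) is
  extend-∷ i []       = ≡-refl
  extend-∷ i (_ ∷ is) = ≡-sym ⊞-assoc

  Choice⇒items : ∀ {L} → Choice (Ready X) L → ∃₂ λ i is → L ≡ₛ choice i is
  Choice⇒items (one r) with r k
  ... | i , eq = i , [] , eq
  Choice⇒items (c or d) with Choice⇒items c | Choice⇒items d
  ... | i , is , eq | j , js , eq' =
    i , is ++ j ∷ js , ≡-trans (c-⊞ eq eq') (choice-++ i is j js)

module _ {X Y Z : Proc → Set} {k : ℕ} (split : ∀ {P} → X P → Y P ⊎ Z P) where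
  -- The seed `P` stands for summands already placed. The recursion first adds the head to the seed,
  -- then moves it from there to the list chosen by `split`.
  partition : ∀ {P} (is : List (Item X k)) → Σ (List (Item Y k)) λ js → Σ (List (Item Z k)) λ ks →
    extend P is ≡ₛ extend (extend P js) ks
  partition [] = [] , [] , ≡-refl
  partition {P} (item C fr A x ∷ is) with partition {P ⊞ fillD C A} is | split x
  ... | js , ks , eq | inj₁ y =
    item C fr A y ∷ js , ks
    , ≡-trans (extend-∷ (item C fr A x) is)
        (≡-trans eq (extend-cong ks (≡-sym (extend-∷ (item C fr A y) js))))
  ... | js , ks , eq | inj₂ z =
    js , item C fr A z ∷ ks
    , ≡-trans (extend-∷ (item C fr A x) is)
        (≡-trans eq (≡-trans (extend-cong ks (extend-⊞ js)) (≡-sym (extend-∷ (item C fr A z) ks))))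

Agrees : ∀ {x A K} → Pre x A K → Proc → Set
Agrees {x} {A} key P = Σ (Pre x A P) λ p → pfx key ⋈ pfx p

Differs : ∀ {x A K} → Pre x A K → Proc → Set
Differs {x} {A} key P = Σ (Pre x A P) λ p → ¬ (pfx key ⋈ pfx p)

-- `Pre1` is not closed under structural congruence, so `L` is first rearranged into `whole`, where
-- the summands agreeing with `key` precede the others.
record Focus (x : Name) (A : Ty) (k : ℕ) (L : Proc) : Set where
  constructor focused
  field
    {keyProc} : Proc
    key       : Pre x A keyProc
    size      : ℕ
    kept      : Fin (suc size) → Item (Agrees key) k
    {whole}   : Proc
    L≡whole   : L ≡ₛ whole
    keeps     : Pre1 x whole (big size (proc ∘ kept))

focus : ∀ {x A L} → Choice (Ready (Pre x A)) L → ∀ k → Focus x A k L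
focus {x} {A} c k with Choice⇒items {k = k} c
-- The first summand supplies the key; any other would do as well.
... | i@(item C fr K key) , is , eq with partition split {fillD C K} is
  where
  split : ∀ {P} → Pre x A P → Agrees key P ⊎ Differs key P
  split p with pfx-⋈? key p
  ... | yes e = inj₁ (p , e)
  ... | no ne = inj₂ (p , ne)
... | js , ks , eq' = focused key (length js) (lookup (first ∷ js))
  (≡-trans eq (≡-trans (≡⇒≡ₛ (choice-extend i is))
    (≡-trans eq' (extend-cong ks (≡⇒≡ₛ (sym (choice-extend first js)))))))
  (pre1 (length js) _ _ (λ j → pfx (proj₁ (ready (good j))))
        (length ks) _ _ (λ j → pfx (proj₁ (ready (lookup ks j))))
        (λ j → Pre⇒HasPfx (proj₁ (ready (good j))))
        -- Agreement is recorded with the key only; as `⋈` is an equivalence, the kept summands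
        -- agree pairwise and disagree with every discarded one.
        (λ j j' → ⋈-trans (⋈-sym (proj₂ (ready (good j)))) (proj₂ (ready (good j'))))
        (λ j → Pre⇒SubjIs (proj₁ (ready (good j))))
        (λ j → Pre⇒HasPfx (proj₁ (ready (lookup ks j))))
        (λ j j' e → proj₂ (ready (lookup ks j')) (⋈-trans (proj₂ (ready (good j))) e))
        (λ j → Pre⇒∈fn (proj₁ (ready (lookup ks j)))))
  where
  first : Item (Agrees key) k
  first = item C fr K (key , ⋈-refl)
  good : Fin (suc (length js)) → Item (Agrees key) k
  good = lookup (first ∷ js)

-- Interaction at a cut

Red : Proc → Set
Red P = Σ (List Name) λ S → Σ Proc λ Q → S ≢ [] × P ⇝[ S ] Q

Red-≡ : ∀ {P P'} → P ≡ₛ P' → Red P' → Red P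
Red-≡ eq (S , Q , S≢[] , r) = S , Q , S≢[] , r-≡ eq r ≡-refl

Red-ν : ∀ {x P Q} → Red P → Red (ν x P Q)
Red-ν (S , _ , S≢[] , r) = S , _ , S≢[] , r-ν r

Red-∥ : ∀ {P Q} → Red P → Red (P ∥ Q)
Red-∥ (S , _ , S≢[] , r) = S , _ , S≢[] , r-∥ r

Red-⊞ : ∀ {P Q} → Red P → Red (P ⊞ Q)
Red-⊞ (S , _ , S≢[] , r) = S , _ , S≢[] , r-⊞ r

-- An oriented form of duality, with the active side first, which halves the cases. Only the
-- outermost prefixes interact, so nothing is asked of the argument types except that label lists
-- match.
data Dual : Ty → Ty → Set where
  𝟏⊥  : Dual 𝟏 ⊥ₜ
  ⊗⅋  : ∀ {A B A' B'} → Dual (A ⊗ B) (A' ⅋ B')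
  ⊕&ₗ : ∀ {ts us} → labels us ≡ labels ts → Dual (⊕ₗ ts) (&ₗ us)
  &⊕₁ : ∀ {A B} → Dual (&₁ A) (⊕₁ B)

dualL-labels : ∀ ts → labels (dualL ts) ≡ labels ts
dualL-labels []             = refl
dualL-labels ((l , _) ∷ ts) = cong (l ∷_) (dualL-labels ts)

dual-Dual : ∀ A → Dual A (dual A) ⊎ Dual (dual A) A
dual-Dual 𝟏       = inj₁ 𝟏⊥
dual-Dual ⊥ₜ      = inj₂ 𝟏⊥
dual-Dual (_ ⊗ _) = inj₁ ⊗⅋
dual-Dual (_ ⅋ _) = inj₂ ⊗⅋
dual-Dual (⊕ₗ ts) = inj₁ (⊕&ₗ (dualL-labels ts))
dual-Dual (&ₗ ts) = inj₂ (⊕&ₗ (sym (dualL-labels ts)))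
dual-Dual (&₁ _)  = inj₁ &⊕₁
dual-Dual (⊕₁ _)  = inj₂ &⊕₁

module _ {x : Name} where
  close-form : ∀ {P} → Pre x 𝟏 P → P ≡ close x
  close-form pre-close = refl

  wait-form : ∀ {P} → Pre x ⊥ₜ P → ∃[ Q ] P ≡ wait x Q
  wait-form pre-wait = _ , refl

  out-form : ∀ {A B P} → Pre x (A ⊗ B) P → ∃[ y ] ∃[ Q ] ∃[ R ] P ≡ out x y Q R
  out-form pre-out = _ , _ , _ , refl

  inp-form : ∀ {A B P} → Pre x (A ⅋ B) P → ∃[ y ] ∃[ Q ] P ≡ inp x y Q
  inp-form pre-inp = _ , _ , refl

  sel-form : ∀ {ts l P} → (p : Pre x (⊕ₗ ts) P) → p-sel x l ⋈ pfx p → ∃[ Q ] P ≡ sel x l Q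
  sel-form (pre-sel _) ⋈-refl = _ , refl

  bra-form : ∀ {ts P} → Pre x (&ₗ ts) P → ∃[ bs ] (labels bs ≡ labels ts × P ≡ bra x bs)
  bra-form (pre-bra e) = _ , e , refl

  some-form : ∀ {A P} → (p : Pre x (&₁ A) P) → p-some x ⋈ pfx p → ∃[ Q ] P ≡ avail x Q
  some-form pre-some _ = _ , refl

  none-form : ∀ {A P} → (p : Pre x (&₁ A) P) → p-none x ⋈ pfx p → P ≡ unavail x
  none-form pre-none _ = refl

  exp-form : ∀ {A ws P} → (p : Pre x (⊕₁ A) P) → p-exp x ws ⋈ pfx p → ∃[ Q ] P ≡ expect x ws Q
  exp-form pre-exp ⋈-refl = _ , refl

label-branch : ∀ {l} (bs : List (Label × Proc)) → l ∈ labels bs → ∃[ P ] (l , P) ∈ bs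
label-branch bs l∈ with ∈-map⁻ proj₁ l∈
... | (_ , P) , m , refl = P , m

Below-big : ∀ {k} n {f : Fin (suc n) → Proc} → Below k (big n f) → ∀ i → Below k (f i)
Below-big zero    p       zero    = p
Below-big (suc n) (p , _) zero    = p
Below-big (suc n) (_ , q) (suc i) = Below-big n q i

fillD-cong : ∀ {P Q} C → P ≡ₛ Q → fillD C P ≡ₛ fillD C Q
fillD-cong hole        e = e
fillD-cong (dpar C _)  e = c-∥ (fillD-cong C e) ≡-refl
fillD-cong (dnu _ C _) e = c-ν (fillD-cong C e) ≡-refl

big-fillD : ∀ {X k} n (is : Fin (suc n) → Item X k) {f : Fin (suc n) → Proc}
  → (∀ i → body (is i) ≡ₛ f i) → big n (proc ∘ is) ≡ₛ big n (λ i → fillD (ctx (is i)) (f i))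
big-fillD n is e = big-cong n λ i → fillD-cong (ctx (is i)) (e i)

unbound : ∀ {X k x} → x < k → (i : Item X k) → ¬ bnD x (ctx i)
unbound x<k i b = <⇒≢ (≤-trans x<k (fresh i _ b)) refl

module _ {x : Name} where
  open Focus

  -- Congruence puts both sides in the shape of `Pre1`, the precongruence drops what disagrees with
  -- the keys, and a second congruence matches the remainder with the redex of an axiom.
  interact-⪰ : ∀ {A B k k' L M P Q R} (l : Focus x A k L) (m : Focus x B k' M)
    → big (size l) (proc ∘ kept l) ≡ₛ P → big (size m) (proc ∘ kept m) ≡ₛ Q
    → ν x P Q ⇝[ x ∷ [] ] R → Red (ν x L M)
  interact-⪰ l m e e' r = _ , _ , (λ ()) ,
    r-≡ (c-ν (L≡whole l) (L≡whole m))
        (r-pre1 (λ _ → (λ i → i) , (λ i → i)) (keeps l) (keeps m) (r-≡ (c-ν e e') r ≡-refl))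
        ≡-refl

  -- r-comm wants a common bound name z on the input side, and the binders around
  -- the outputs fresh for it: hence M is renamed before the bound for L is chosen.
  interact-⊗⅋ : ∀ {A B A' B' L M} → (∀ k → Focus x (A ⊗ B) k L) → Focus x (A' ⅋ B') (suc x) M
    → Red (ν x L M)
  interact-⊗⅋ fl m with bound-with 0 x (big (size m) (proc ∘ kept m))
  ... | z , _ , x<z , belowM = red
    where
    inp? : ∀ j → ∃[ y ] ∃[ R ] body (kept m j) ≡ inp x y R
    inp? j = inp-form (proj₁ (ready (kept m j)))

    belowR : ∀ j → Below z (proj₁ (proj₂ (inp? j)))
    belowR j with inp? j | Below-body (ctx (kept m j)) (Below-big (size m) belowM j)
    ... | _ , _ , eq | p with subst (Below z) eq p
    ... | _ , _ , q = q

    renamed : ∀ j → ∃ (Sub z (proj₁ (inp? j)) (proj₁ (proj₂ (inp? j))))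
    renamed j = rename _ _ (belowR j)

    R : Fin (suc (size m)) → Proc
    R j = proj₁ (renamed j)

    M' : Proc
    M' = big (size m) (λ j → fillD (ctx (kept m j)) (inp x z (R j)))

    M≡M' : big (size m) (proc ∘ kept m) ≡ₛ M'
    M≡M' = big-fillD (size m) (kept m) λ j →
      ≡-trans (≡⇒≡ₛ (proj₂ (proj₂ (inp? j))))
              (α-inp (Below⇒∉fn (belowR j) ≤-refl) (proj₂ (renamed j)))

    red : Red _
    red with bound (suc x) M'
    ... | k , x<k , belowM' with fl k
    -- `w` names the transmitted channel: it lies above every name on both sides, so it is neither
    -- free in them nor bound there.
    ... | l with bound-two k M' (big (size l) (proc ∘ kept l))
    ... | w , k≤w , belowM'w , belowL = interact-⪰ l m
        (big-fillD (size l) (kept l) λ i → ≡⇒≡ₛ (proj₂ (proj₂ (proj₂ (out? i)))))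
        M≡M'
        (r-comm (size l) _ _ _ _ (λ i → proj₁ (rename _ _ (belowP i)))
                (size m) _ z w R (λ j → proj₁ (rename z _ (belowRw j)))
                (λ i → proj₂ (rename _ _ (belowP i)))
                (λ j → proj₂ (rename z _ (belowRw j)))
                (λ i → unbound x<k (kept l i))
                (λ j → unbound ≤-refl (kept m j))
                (λ i b b∈ → Below⇒∉fn belowM' (fresh (kept l i) b b∈))
                (λ i → Below⇒∉fn (belowP i) ≤-refl)
                (λ j b → <⇒≢ (Below-ctx (ctx (kept m j)) (Below-big (size m) belowM'w j) w b) refl)
                (λ j → Below⇒∉fn (Below-big (size m) belowM'w j) ≤-refl))
      where
      out? : ∀ i → ∃[ y ] ∃[ P ] ∃[ Q ] body (kept l i) ≡ out x y P Q
      out? i = out-form (proj₁ (ready (kept l i)))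

      belowP : ∀ i → Below w (proj₁ (proj₂ (out? i)))
      belowP i with out? i | Below-body (ctx (kept l i)) (Below-big (size l) belowL i)
      ... | _ , _ , _ , eq | p with subst (Below w) eq p
      ... | _ , _ , q , _ = q

      belowRw : ∀ j → Below w (R j)
      belowRw j = proj₂ (proj₂ (Below-body (ctx (kept m j)) (Below-big (size m) belowM'w j)))

  interact : ∀ {A B L M} → Dual A B → (∀ k → Focus x A k L) → (∀ k → Focus x B k M)
    → Red (ν x L M)
  interact 𝟏⊥ fl fm = interact-⪰ l m
      (big-fillD (size l) (kept l) λ i → ≡⇒≡ₛ (close-form (proj₁ (ready (kept l i)))))
      (big-fillD (size m) (kept m) λ j → ≡⇒≡ₛ (proj₂ (wait-form (proj₁ (ready (kept m j))))))
      (r-close (size l) _ (size m) _ _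
        (λ i → unbound ≤-refl (kept l i)) (λ j → unbound ≤-refl (kept m j)))
    where
    -- All context binders are at least `suc x`, hence none of them captures `x`.
    l = fl (suc x)
    m = fm (suc x)
  interact ⊗⅋ fl fm = interact-⊗⅋ fl (fm (suc x))
  -- The key of the selecting side fixes the label `a`; every branching summand offers exactly the
  -- labels of the type, so each has a branch for `a`.
  interact (⊕&ₗ {ts} eq) fl fm with fl (suc x) | fm (suc x)
  ... | l@(focused (pre-sel {l = a} a∈ts) n is _ _) | m@(focused _ n' js _ _) = interact-⪰ l m
      (big-fillD n is λ i → ≡⇒≡ₛ (proj₂ (sel-form (proj₁ (ready (is i))) (proj₂ (ready (is i))))))
      (big-fillD n' js λ j → ≡⇒≡ₛ (proj₂ (proj₂ (bra? j))))
      (r-sel n _ _ n' _ (λ j → proj₁ (bra? j)) (labels ts) a (λ j → proj₁ (branch j))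
        (λ j → ↭-reflexive (labels≡ j)) (λ j → proj₂ (branch j))
        (λ i → unbound ≤-refl (is i)) (λ j → unbound ≤-refl (js j)))
    where
    bra? : ∀ j → _
    bra? j = bra-form (proj₁ (ready (js j)))

    labels≡ : ∀ j → labels (proj₁ (bra? j)) ≡ labels ts
    labels≡ j = trans (proj₁ (proj₂ (bra? j))) eq

    branch : ∀ j → ∃[ P ] (a , P) ∈ proj₁ (bra? j)
    branch j = label-branch _ (subst (a ∈_) (sym (labels≡ j)) a∈ts)
  -- The key of the left side decides between (Some) and (None); `ws` comes from the key of the
  -- expecting side.
  interact &⊕₁ fl fm with fl (suc x) | fm (suc x)
  ... | l@(focused pre-some n is _ _) | m@(focused (pre-exp {ws = ws}) n' js _ _) = interact-⪰ l m
      (big-fillD n is λ i → ≡⇒≡ₛ (proj₂ (some-form (proj₁ (ready (is i))) (proj₂ (ready (is i))))))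
      (big-fillD n' js λ j → ≡⇒≡ₛ (proj₂ (exp-form (proj₁ (ready (js j))) (proj₂ (ready (js j))))))
      (r-some n _ _ n' _ ws _ (λ i → unbound ≤-refl (is i)) (λ j → unbound ≤-refl (js j)))
  ... | l@(focused pre-none n is _ _) | m@(focused (pre-exp {ws = ws}) n' js _ _) = interact-⪰ l m
      (big-fillD n is λ i → ≡⇒≡ₛ (none-form (proj₁ (ready (is i))) (proj₂ (ready (is i)))))
      (big-fillD n' js λ j → ≡⇒≡ₛ (proj₂ (exp-form (proj₁ (ready (js j))) (proj₂ (ready (js j))))))
      (r-none n _ n' _ ws _ (λ i → unbound ≤-refl (is i)) (λ j → unbound ≤-refl (js j)))

interact-dual : ∀ {x A L M}
  → Choice (Ready (Pre x A)) L → Choice (Ready (Pre x (dual A))) M → Red (ν x L M)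
interact-dual {A = A} c d with dual-Dual A
... | inj₁ dl = interact dl (focus c) (focus d)
... | inj₂ dl = Red-≡ ν-comm (interact dl (focus d) (focus c))

-- (Id) fires whatever stands on the other side of the cut, so `U` needs no readiness; only capture
-- has to be excluded.
forward : ∀ {x y T U} → Ready (Fwd x y) T → Red (ν x T U)
-- Binders above `y` make the substitution of `y` for `x` defined; the bound `k` chosen next keeps
-- the context binders off `x` and off the free names of `U'`.
forward {x} {y} {T} {U} r with freshen (suc y) U
... | U' , eqU , bU' with bound (suc x) U'
... | k , x<k , belowU' with r k
... | i@(item C fr _ fwd) , eqT =
  _ , _ , (λ ()) ,
  r-≡ (c-ν eqT eqU)
      (r-id 0 (λ _ → C)
        (proj₂ (Sub-total x U' (AllBound-map (λ y<b → ≢-sym (<⇒≢ y<b)) U' bU')))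
        (λ _ → unbound x<k i) (λ _ b b∈ → Below⇒∉fn belowU' (fr b b∈)))
      ≡-refl

-- Lifting choices

_∘N_ : NCtx → NCtx → NCtx
nhole     ∘N M = M
npar N P  ∘N M = npar (N ∘N M) P
nnu x N P ∘N M = nnu x (N ∘N M) P
nch N P   ∘N M = nch (N ∘N M) P

fillN-∘ : ∀ N M R → fillN (N ∘N M) R ≡ fillN N (fillN M R)
fillN-∘ nhole       M R = refl
fillN-∘ (npar N P)  M R = cong (_∥ P) (fillN-∘ N M R)
fillN-∘ (nnu x N P) M R = cong (λ Q → ν x Q P) (fillN-∘ N M R)
fillN-∘ (nch N P)   M R = cong (_⊞ P) (fillN-∘ N M R)

fillN-cong : ∀ {P Q} N → P ≡ₛ Q → fillN N P ≡ₛ fillN N Q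
fillN-cong nhole       e = e
fillN-cong (npar N _)  e = c-∥ (fillN-cong N e) ≡-refl
fillN-cong (nnu _ N _) e = c-ν (fillN-cong N e) ≡-refl
fillN-cong (nch N _)   e = c-⊞ (fillN-cong N e) ≡-refl

infix 4 _⊑_

-- Rule (ν⊞) acts inside a cut, at any depth of an ND-context. Quantifying over the cut and the
-- context turns it into a preorder compatible with ND-contexts; only the existence of a reduction
-- is transferred, not its result.
record _⊑_ (P Q : Proc) : Set where
  constructor lift
  field
    below : ∀ N x R → Red (ν x R (fillN N Q)) → Red (ν x R (fillN N P))

open _⊑_

≡ₛ⇒⊑ : ∀ {P Q} → P ≡ₛ Q → P ⊑ Q
≡ₛ⇒⊑ e = lift λ N x R → Red-≡ (c-ν ≡-refl (fillN-cong N e))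

⊑-trans : ∀ {P Q R} → P ⊑ Q → Q ⊑ R → P ⊑ R
⊑-trans p q = lift λ N x R r → below p N x R (below q N x R r)

⊑-fillN : ∀ {P Q} M → P ⊑ Q → fillN M P ⊑ fillN M Q
⊑-fillN {P} {Q} M p = lift λ N x R r →
  subst (λ T → Red (ν x R T)) (fillN-∘ N M P)
    (below p (N ∘N M) x R (subst (λ T → Red (ν x R T)) (sym (fillN-∘ N M Q)) r))

⊑-⊞ : ∀ {P P' Q Q'} → P ⊑ P' → Q ⊑ Q' → P ⊞ Q ⊑ P' ⊞ Q'
⊑-⊞ p q = ⊑-trans (⊑-fillN (nch nhole _) p)
  (⊑-trans (≡ₛ⇒⊑ ⊞-comm) (⊑-trans (⊑-fillN (nch nhole _) q) (≡ₛ⇒⊑ ⊞-comm)))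

-- Exactly rule (ν⊞), whose premise speaks of the distributed process and whose conclusion of the
-- original one.
⊑-distrib : ∀ {P Q} C → fillD C (P ⊞ Q) ⊑ fillD C P ⊞ fillD C Q
⊑-distrib C = lift λ { N x R (S , T , S≢[] , r) → S , T , S≢[] , r-ν⊞ N C r }

-- Parallel composition and cut multiply out choices in the same way; commutativity reduces
-- everything to distribution in the left factor.
module Product (_∙_ : Proc → Proc → Proc)
  (∙-comm : ∀ {P Q} → (P ∙ Q) ≡ₛ (Q ∙ P))
  (∙-⊑ : ∀ {P P' Q} → P ⊑ P' → (P ∙ Q) ⊑ (P' ∙ Q))
  (∙-distrib : ∀ {P P' Q} → ((P ⊞ P') ∙ Q) ⊑ ((P ∙ Q) ⊞ (P' ∙ Q)))
  where

  ∙-⊑₂ : ∀ {P P' Q Q'} → P ⊑ P' → Q ⊑ Q' → (P ∙ Q) ⊑ (P' ∙ Q')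
  ∙-⊑₂ p q = ⊑-trans (∙-⊑ p) (⊑-trans (≡ₛ⇒⊑ ∙-comm) (⊑-trans (∙-⊑ q) (≡ₛ⇒⊑ ∙-comm)))

  product : ∀ {X Y Z : Proc → Set} {P Q} → (∀ {T U} → X T → Y U → Z (T ∙ U))
    → Choice X P → Choice Y Q → ∃[ R ] ((P ∙ Q) ⊑ R × Choice Z R)
  product f (one x) (one y) = _ , ≡ₛ⇒⊑ ≡-refl , one (f x y)
  product f (one x) (d or d') with product f (one x) d | product f (one x) d'
  ... | _ , le , c | _ , le' , c' =
    _ , ⊑-trans (≡ₛ⇒⊑ ∙-comm) (⊑-trans ∙-distrib
          (⊑-⊞ (⊑-trans (≡ₛ⇒⊑ ∙-comm) le) (⊑-trans (≡ₛ⇒⊑ ∙-comm) le')))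
      , c or c'
  product f (c or c') d with product f c d | product f c' d
  ... | _ , le , e | _ , le' , e' = _ , ⊑-trans ∙-distrib (⊑-⊞ le le') , e or e'

  product-⊑ : ∀ {X Y Z : Proc → Set} {P Q} → (∀ {T U} → X T → Y U → Z (T ∙ U))
    → ∃[ P' ] (P ⊑ P' × Choice X P') → ∃[ Q' ] (Q ⊑ Q' × Choice Y Q')
    → ∃[ R ] ((P ∙ Q) ⊑ R × Choice Z R)
  product-⊑ f (_ , p , c) (_ , q , d) with product f c d
  ... | R , le , e = R , ⊑-trans (∙-⊑₂ p q) le , e

module ∥-Product = Product _∥_ ∥-comm (⊑-fillN (npar nhole _)) (⊑-distrib (dpar hole _))
module ν-Product (x : Name) =
  Product (ν x) ν-comm (⊑-fillN (nnu x nhole _)) (⊑-distrib (dnu x hole _))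

-- Progress of choice-free forests

-- Membership in `Γ` expresses that the names on which the forest is ready are free, and gives a
-- prefix its type.
data Live (Γ : Ctx) (T : Proc) : Set where
  reduces   : Red T → Live Γ T
  prefix    : ∀ {x A} → (x , A) ∈ Γ → Ready (Pre x A) T → Live Γ T
  forwarder : ∀ {x A y B} → (x , A) ∈ Γ → (y , B) ∈ Γ → x ≢ y → Ready (Fwd x y) T → Live Γ T

Status : Ctx → Proc → Set
Status Γ T = (Γ ≡ [] × T ≡ₛ 𝟎) ⊎ Live Γ T

Live-⊆ : ∀ {Γ Δ T} → (∀ {p} → p ∈ Γ → p ∈ Δ) → Live Γ T → Live Δ T
Live-⊆ i (reduces r)           = reduces r
Live-⊆ i (prefix m p)          = prefix (i m) p
Live-⊆ i (forwarder m m' ne f) = forwarder (i m) (i m') ne f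

Live-≡ : ∀ {Γ T T'} → T ≡ₛ T' → Live Γ T' → Live Γ T
Live-≡ e (reduces r)           = reduces (Red-≡ e r)
Live-≡ e (prefix m p)          = prefix m (Ready-≡ e p)
Live-≡ e (forwarder m m' ne f) = forwarder m m' ne (Ready-≡ e f)

Live-∥ : ∀ {Γ T U} → Live Γ T → Live Γ (T ∥ U)
Live-∥ (reduces r)           = reduces (Red-∥ r)
Live-∥ (prefix m p)          = prefix m (Ready-∥ p)
Live-∥ (forwarder m m' ne f) = forwarder m m' ne (Ready-∥ f)

Fwd-sym : ∀ {x y T} → Ready (Fwd x y) T → Ready (Fwd y x) T
Fwd-sym r k with r k
... | item C fr _ fwd , eq = item C fr _ fwd , ≡-trans eq (fillD-cong C fwd-sym)

∈⇒≢ : ∀ {z x} {A : Ty} {Γ} → All (z ≢_) (dom Γ) → (x , A) ∈ Γ → x ≢ z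
∈⇒≢ z∉ m = ≢-sym (All.lookup z∉ (∈-map⁺ proj₁ m))

-- Readiness on names other than `z` survives the cut, and a forwarder touching `z` fires (Id). What
-- is left is a prefix on `z`, which waits for the other side.
Live-ν : ∀ {z A Γ T} → All (z ≢_) (dom Γ) → Live ((z , A) ∷ Γ) T
  → (∀ {U} → Live Γ (ν z T U)) ⊎ Ready (Pre z A) T
Live-ν z∉ (reduces r)           = inj₁ (reduces (Red-ν r))
Live-ν z∉ (prefix (here refl) p) = inj₂ p
Live-ν z∉ (prefix (there m) p)   = inj₁ (prefix m (Ready-ν (Pre-stable (∈⇒≢ z∉ m)) p))
Live-ν z∉ (forwarder (here refl) _ _ f) = inj₁ (reduces (forward f))
Live-ν z∉ (forwarder (there _) (here refl) _ f) = inj₁ (reduces (forward (Fwd-sym f)))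
Live-ν z∉ (forwarder (there m) (there m') ne f) =
  inj₁ (forwarder m m' ne (Ready-ν (Fwd-stable (∈⇒≢ z∉ m) (∈⇒≢ z∉ m')) f))

Status-cut : ∀ {x A Γ Δ T U} → Distinct ((x , A) ∷ Γ) → Distinct ((x , dual A) ∷ Δ)
  → Status ((x , A) ∷ Γ) T → Status ((x , dual A) ∷ Δ) U → Status (Γ ++ Δ) (ν x T U)
-- The name `x` makes both contexts non-empty, so neither side falls under the inaction case.
Status-cut {Γ = Γ} (x∉Γ ∷ _) (x∉Δ ∷ _) (inj₂ s) (inj₂ t) with Live-ν x∉Γ s | Live-ν x∉Δ t
... | inj₁ live | _         = inj₂ (Live-⊆ ∈-++⁺ˡ live)
... | inj₂ _    | inj₁ live = inj₂ (Live-≡ ν-comm (Live-⊆ (∈-++⁺ʳ Γ) live))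
... | inj₂ p    | inj₂ q    = inj₂ (reduces (interact-dual (one p) (one q)))

Status-mix : ∀ {Γ Δ T U} → Status Γ T → Status Δ U → Status (Γ ++ Δ) (T ∥ U)
Status-mix (inj₁ (refl , e)) (inj₁ (refl , e')) = inj₁ (refl , ≡-trans (c-∥ e e') ∥-unit)
Status-mix {Γ} _ (inj₂ t)    = inj₂ (Live-≡ ∥-comm (Live-∥ (Live-⊆ (∈-++⁺ʳ Γ) t)))
Status-mix (inj₂ s) (inj₁ _) = inj₂ (Live-∥ (Live-⊆ ∈-++⁺ˡ s))

Status-↭ : ∀ {Γ Δ T} → Γ ↭ Δ → Status Γ T → Status Δ T
Status-↭ p (inj₁ (refl , e)) = inj₁ (↭-empty-inv (↭-sym p) , e)
Status-↭ p (inj₂ s)          = inj₂ (Live-⊆ (∈-resp-↭ p) s)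

-- From typing derivations to choices of forests

⊢⇒Distinct : ∀ {P Γ} → P ⊢ Γ → Distinct Γ
⊢⇒Distinct (⊢-cut _ _ d)  = d
⊢⇒Distinct (⊢-mix _ _ d)  = d
⊢⇒Distinct (⊢-⊞ p _)      = ⊢⇒Distinct p
⊢⇒Distinct ⊢-𝟎            = []
⊢⇒Distinct (⊢-fwd _ x≢y)  = (x≢y ∷ []) ∷ [] ∷ []
⊢⇒Distinct ⊢-close        = [] ∷ []
⊢⇒Distinct (⊢-wait _ d)   = d
⊢⇒Distinct (⊢-out _ _ d)  = d
⊢⇒Distinct (⊢-inp p) with ⊢⇒Distinct p
... | _ ∷ d = d
⊢⇒Distinct (⊢-sel p _ _) with ⊢⇒Distinct p
... | d ∷ ds = d ∷ ds
⊢⇒Distinct (⊢-bra _ _ _ d) = d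
⊢⇒Distinct (⊢-some p) with ⊢⇒Distinct p
... | d ∷ ds = d ∷ ds
⊢⇒Distinct (⊢-none _)     = [] ∷ []
⊢⇒Distinct (⊢-exp p _ _) with ⊢⇒Distinct p
... | d ∷ ds = d ∷ ds
⊢⇒Distinct (⊢-exch p e)   = Unique-resp-↭ (setoid Name) (↭⇒↭ₛ (map⁺ proj₁ e)) (⊢⇒Distinct p)

BrTy-labels : ∀ {x Γ bs ts} → BrTy x Γ bs ts → labels bs ≡ labels ts
BrTy-labels bt-[]      = refl
BrTy-labels (bt-∷ _ b) = cong (_ ∷_) (BrTy-labels b)

expand-pre : ∀ {x A P Γ} → Pre x A P → ∃[ P' ] (P ⊑ P' × Choice (Status ((x , A) ∷ Γ)) P')
expand-pre p = _ , ≡ₛ⇒⊑ ≡-refl , one (inj₂ (prefix (here refl) (Ready-here p)))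

-- By induction on the typing derivation, down to the first prefixes. The status of each forest is
-- built while choices are multiplied out, so forests need no datatype of their own.
expand : ∀ {P Γ} → P ⊢ Γ → ∃[ P' ] (P ⊑ P' × Choice (Status Γ) P')
expand (⊢-cut {x} p q _) =
  ν-Product.product-⊑ x (Status-cut (⊢⇒Distinct p) (⊢⇒Distinct q)) (expand p) (expand q)
expand (⊢-mix p q _) = ∥-Product.product-⊑ Status-mix (expand p) (expand q)
expand (⊢-⊞ p q) with expand p | expand q
... | _ , le , c | _ , le' , c' = _ , ⊑-⊞ le le' , c or c'
expand ⊢-𝟎 = _ , ≡ₛ⇒⊑ ≡-refl , one (inj₁ (refl , ≡-refl))
expand (⊢-fwd _ x≢y) =
  _ , ≡ₛ⇒⊑ ≡-refl
    , one (inj₂ (forwarder (here refl) (there (here refl)) x≢y (Ready-here fwd)))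
expand ⊢-close         = expand-pre pre-close
expand (⊢-wait _ _)    = expand-pre pre-wait
expand (⊢-out _ _ _)   = expand-pre pre-out
expand (⊢-inp _)       = expand-pre pre-inp
expand (⊢-sel _ m _)   = expand-pre (pre-sel (∈-map⁺ proj₁ m))
expand (⊢-bra b _ _ _) = expand-pre (pre-bra (BrTy-labels b))
expand (⊢-some _)      = expand-pre pre-some
expand (⊢-none _)      = expand-pre pre-none
expand (⊢-exp _ _ _)   = expand-pre pre-exp
expand (⊢-exch p e) with expand p
... | _ , le , c = _ , le , Choice-map (Status-↭ e) c

-- Progress of closed processes

reduces-or-all : ∀ {X P} → Choice (λ T → Red T ⊎ X T) P → Red P ⊎ Choice X P
reduces-or-all (one (inj₁ r)) = inj₁ r
reduces-or-all (one (inj₂ x)) = inj₂ (one x)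
reduces-or-all (c or d) with reduces-or-all c | reduces-or-all d
-- Reduction leaves the other summands in place, so one reducing summand is enough.
... | inj₁ r  | _       = inj₁ (Red-⊞ r)
... | inj₂ _  | inj₁ r  = inj₁ (Red-≡ ⊞-comm (Red-⊞ r))
... | inj₂ c' | inj₂ d' = inj₂ (c' or d')

Status-singleton : ∀ {x A T} → Status ((x , A) ∷ []) T → Red T ⊎ Ready (Pre x A) T
Status-singleton (inj₂ (reduces r))            = inj₁ r
Status-singleton (inj₂ (prefix (here refl) p)) = inj₂ p
Status-singleton (inj₂ (forwarder (here refl) (here refl) ne _)) = ⊥-elim (ne refl)

cut-progress : ∀ {x A P Q} → P ⊢ (x , A) ∷ [] → Q ⊢ (x , dual A) ∷ [] → Red (ν x P Q)
cut-progress {x} p q with expand p | expand q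
... | P' , P⊑P' , c | Q' , Q⊑Q' , d =
  -- `_⊑_` works on the right-hand side of a cut, so the left side is expanded between two uses of
  -- commutativity.
  below Q⊑Q' nhole x _ (Red-≡ ν-comm (below P⊑P' nhole x _ (Red-≡ ν-comm expanded)))
  where
  expanded : Red (ν x P' Q')
  expanded with reduces-or-all (Choice-map Status-singleton c)
              | reduces-or-all (Choice-map Status-singleton d)
  ... | inj₁ r  | _       = Red-ν r
  ... | inj₂ _  | inj₁ r  = Red-≡ ν-comm (Red-ν r)
  ... | inj₂ c' | inj₂ d' = interact-dual c' d'

progress : ∀ {P Γ} → P ⊢ Γ → Γ ≡ [] → P ≡ₛ 𝟎 ⊎ Red P
progress (⊢-cut {Γ = Γ} {Δ = Δ} p q _) e
  with refl ← ++-conicalˡ Γ Δ e | refl ← ++-conicalʳ Γ Δ e = inj₂ (cut-progress p q)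
progress (⊢-mix {Γ = Γ} {Δ} p q _) e
  with progress p (++-conicalˡ Γ Δ e) | progress q (++-conicalʳ Γ Δ e)
... | inj₁ z | inj₁ z' = inj₁ (≡-trans (c-∥ z z') ∥-unit)
... | inj₂ r | _       = inj₂ (Red-∥ r)
... | inj₁ _ | inj₂ r  = inj₂ (Red-≡ ∥-comm (Red-∥ r))
progress (⊢-⊞ p q) e with progress p e | progress q e
... | inj₁ z | inj₁ z' = inj₁ (≡-trans (c-⊞ z z') ⊞-idem)
... | inj₂ r | _       = inj₂ (Red-⊞ r)
... | inj₁ _ | inj₂ r  = inj₂ (Red-≡ ⊞-comm (Red-⊞ r))
progress ⊢-𝟎           e    = inj₁ ≡-refl
progress (⊢-exch p s)  refl = progress p (↭-empty-inv s)

mainTheorem2 : (P : Proc) → P ⊢ [] → ¬ (P ≡ₛ 𝟎)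
    → Σ (List Name) (λ S → Σ Proc (λ Q → (S ≢ []) × (P ⇝[ S ] Q)))
mainTheorem2 P p P≢𝟎 with progress p refl
... | inj₁ z = ⊥-elim (P≢𝟎 z)
... | inj₂ r = r
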